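{- For $n\in\mathbb{N}$, $\mathcal{C}_n = (1-\log 2)n+O\left(\sqrt{n}\right)$, and hence $\lim_{n\to\infty}\frac{1}{n}\mathcal{C}_n=1-\log 2$.
   Context: $\mathbb{N}$ denotes the set of positive integers, $\lceil\cdot\rceil$ the ceiling function, and $\log$ the natural logarithm. For $n\in\mathbb{N}$, $\mathcal{C}_n = \#\{k\in\mathbb{Z} : 1\le k\le n,\ \lceil n/k\rceil\text{ is odd}\}$. Big O notation: $f(n)=O(g(n))$ means there exist constants $M$ and $a$ such that $|f(n)|\le M g(n)$ for all $n\ge a$. -}

module Defs where

open import Data.Integer.Base as ℤ using (ℤ; +_; -[1+_])
open import Data.Integer.Divisibility as ℤ using ()
import Data.Integer.Properties as ℤ
open import Data.List.Base using (length; filter; upTo)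
open import Data.Nat.Base as ℕ using (ℕ; zero; suc; NonZero; s≤s; z≤n; z<s)
import Data.Nat.Divisibility as ℕ
import Data.Nat.Properties as ℕ
open import Data.Product.Base using (Σ; ∃; ∃-syntax; _×_; _,_; proj₁; proj₂)
open import Data.Sum.Base using (inj₁; inj₂)
open import Data.Rational.Base as ℚ using (ℚ; mkℚ; 0ℚ; 1ℚ; ½; Positive; ceiling; *≤*)
import Data.Rational.Properties as ℚ
open import Data.Rational.Solver using (module +-*-Solver)
import Data.Rational.Unnormalised.Base as ℚᵘ
import Data.Rational.Unnormalised.Properties as ℚᵘ
open import Relation.Binary.PropositionalEquality
open import Relation.Nullary using (¬_; Dec; yes; no; ¬?; contradiction)
open +-*-Solver using (solve; _:=_; _:+_; _:*_; _:-_; :-_; con)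

ι : ℕ → ℚ
ι n = + n ℚ./ 1

private
  ι≃ : ∀ n → ℚ.toℚᵘ (ι n) ℚᵘ.≃ ℚᵘ.mkℚᵘ (+ n) 0
  ι≃ n = ℚ.toℚᵘ-fromℚᵘ (ℚᵘ.mkℚᵘ (+ n) 0)

ι-+ : ∀ m n → ι (m ℕ.+ n) ≡ ι m ℚ.+ ι n
ι-+ m n = ℚ.toℚᵘ-injective (begin
  ℚ.toℚᵘ (ι (m ℕ.+ n))                       ≈⟨ ι≃ (m ℕ.+ n) ⟩
  ℚᵘ.mkℚᵘ (+ (m ℕ.+ n)) 0                    ≈⟨ ℚᵘ.*≡* (cong (ℤ._* + 1) (trans (ℤ.pos-+ m n)
                                                 (sym (cong₂ ℤ._+_ (ℤ.*-identityʳ (+ m)) (ℤ.*-identityʳ (+ n)))))) ⟩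
  ℚᵘ.mkℚᵘ (+ m) 0 ℚᵘ.+ ℚᵘ.mkℚᵘ (+ n) 0       ≈⟨ ℚᵘ.+-cong (ι≃ m) (ι≃ n) ⟨
  ℚ.toℚᵘ (ι m) ℚᵘ.+ ℚ.toℚᵘ (ι n)             ≈⟨ ℚ.toℚᵘ-homo-+ (ι m) (ι n) ⟨
  ℚ.toℚᵘ (ι m ℚ.+ ι n)                       ∎)
  where open ℚᵘ.≃-Reasoning

ι-* : ∀ m n → ι (m ℕ.* n) ≡ ι m ℚ.* ι n
ι-* m n = ℚ.toℚᵘ-injective (begin
  ℚ.toℚᵘ (ι (m ℕ.* n))                       ≈⟨ ι≃ (m ℕ.* n) ⟩
  ℚᵘ.mkℚᵘ (+ (m ℕ.* n)) 0                    ≈⟨ ℚᵘ.*≡* (cong (ℤ._* + 1) (ℤ.pos-* m n)) ⟩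
  ℚᵘ.mkℚᵘ (+ m) 0 ℚᵘ.* ℚᵘ.mkℚᵘ (+ n) 0       ≈⟨ ℚᵘ.*-cong (ι≃ m) (ι≃ n) ⟨
  ℚ.toℚᵘ (ι m) ℚᵘ.* ℚ.toℚᵘ (ι n)             ≈⟨ ℚ.toℚᵘ-homo-* (ι m) (ι n) ⟨
  ℚ.toℚᵘ (ι m ℚ.* ι n)                       ∎)
  where open ℚᵘ.≃-Reasoning

ι-mono-≤ : ∀ {m n} → m ℕ.≤ n → ι m ℚ.≤ ι n
ι-mono-≤ {m} {n} m≤n = ℚ.toℚᵘ-cancel-≤ (begin
  ℚ.toℚᵘ (ι m)      ≃⟨ ι≃ m ⟩
  ℚᵘ.mkℚᵘ (+ m) 0   ≤⟨ ℚᵘ.*≤* (ℤ.*-monoʳ-≤-nonNeg (+ 1) (ℤ.+≤+ m≤n)) ⟩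
  ℚᵘ.mkℚᵘ (+ n) 0   ≃⟨ ι≃ n ⟨
  ℚ.toℚᵘ (ι n)      ∎)
  where open ℚᵘ.≤-Reasoning

ι-mono-< : ∀ {m n} → m ℕ.< n → ι m ℚ.< ι n
ι-mono-< {m} {n} m<n = ℚ.toℚᵘ-cancel-< (begin-strict
  ℚ.toℚᵘ (ι m)      ≃⟨ ι≃ m ⟩
  ℚᵘ.mkℚᵘ (+ m) 0   <⟨ ℚᵘ.*<* (ℤ.*-monoʳ-<-pos (+ 1) (ℤ.+<+ m<n)) ⟩
  ℚᵘ.mkℚᵘ (+ n) 0   ≃⟨ ι≃ n ⟨
  ℚ.toℚᵘ (ι n)      ∎)
  where open ℚᵘ.≤-Reasoning

0≤ι : ∀ n → 0ℚ ℚ.≤ ι n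
0≤ι n = ι-mono-≤ {0} {n} z≤n

/-ι : ∀ i n .{{_ : NonZero n}} → (+ i ℚ./ n) ℚ.* ι n ≡ ι i
/-ι i n@(suc n-1) = ℚ.toℚᵘ-injective (begin
  ℚ.toℚᵘ ((+ i ℚ./ n) ℚ.* ι n)                 ≈⟨ ℚ.toℚᵘ-homo-* (+ i ℚ./ n) (ι n) ⟩
  ℚ.toℚᵘ (+ i ℚ./ n) ℚᵘ.* ℚ.toℚᵘ (ι n)         ≈⟨ ℚᵘ.*-cong (ℚ.toℚᵘ-fromℚᵘ (ℚᵘ.mkℚᵘ (+ i) n-1)) (ι≃ n) ⟩
  ℚᵘ.mkℚᵘ (+ i) n-1 ℚᵘ.* ℚᵘ.mkℚᵘ (+ n) 0       ≈⟨ ℚᵘ.*≡* lem ⟩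
  ℚᵘ.mkℚᵘ (+ i) 0                              ≈⟨ ι≃ i ⟨
  ℚ.toℚᵘ (ι i)                                 ∎)
  where
  open ℚᵘ.≃-Reasoning
  lem : (+ i ℤ.* + n) ℤ.* + 1 ≡ + i ℤ.* + (n ℕ.* 1)
  lem = trans (ℤ.*-identityʳ (+ i ℤ.* + n)) (cong (λ k → + i ℤ.* + k) (sym (ℕ.*-identityʳ n)))

archimedean : ∀ p → ∃[ n ] p ℚ.< ι n
archimedean p@(mkℚ i d _) = suc ℤ.∣ i ∣ , ℚ.≤-<-trans p≤ (ι-mono-< {ℤ.∣ i ∣} {suc ℤ.∣ i ∣} ℕ.≤-refl)
  where
  open ℤ.≤-Reasoning
  p≤ : p ℚ.≤ ι ℤ.∣ i ∣
  p≤ = ℚ.toℚᵘ-cancel-≤ (ℚᵘ.≤-respʳ-≃ (ℚᵘ.≃-sym (ι≃ ℤ.∣ i ∣)) (ℚᵘ.*≤* (begin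
    i ℤ.* + 1             ≡⟨ ℤ.*-identityʳ i ⟩
    i                     ≤⟨ i≤∣i∣ i ⟩
    + ℤ.∣ i ∣             ≤⟨ ℤ.+≤+ (ℕ.m≤m*n ℤ.∣ i ∣ (suc d)) ⟩
    + (ℤ.∣ i ∣ ℕ.* suc d) ≡⟨ ℤ.pos-* ℤ.∣ i ∣ (suc d) ⟩
    + ℤ.∣ i ∣ ℤ.* + suc d ∎)))
    where
    i≤∣i∣ : ∀ j → j ℤ.≤ + ℤ.∣ j ∣
    i≤∣i∣ (+ n)    = ℤ.≤-refl
    i≤∣i∣ -[1+ n ] = ℤ.-≤+

E/n→0 : ∀ E → 0ℚ ℚ.≤ E → ∀ ε → 0ℚ ℚ.< ε →
        ∃[ N ] ∀ n .{{_ : NonZero n}} → N ℕ.≤ n → E ℚ.* (+ 1 ℚ./ n) ℚ.< ε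
E/n→0 E 0≤E ε 0<ε = N , λ n N≤n →
  ℚ.*-cancelʳ-<-nonNeg (ι n) {{ℚ.nonNegative (0≤ι n)}} (begin-strict
    E ℚ.* (+ 1 ℚ./ n) ℚ.* ι n     ≡⟨ ℚ.*-assoc E (+ 1 ℚ./ n) (ι n) ⟩
    E ℚ.* ((+ 1 ℚ./ n) ℚ.* ι n)   ≡⟨ cong (E ℚ.*_) (/-ι 1 n) ⟩
    E ℚ.* 1ℚ                      ≡⟨ cong (E ℚ.*_) (ℚ.*-inverseˡ ε) ⟨
    E ℚ.* ((ℚ.1/ ε) ℚ.* ε)        ≡⟨ ℚ.*-assoc E (ℚ.1/ ε) ε ⟨
    E ℚ.* (ℚ.1/ ε) ℚ.* ε          <⟨ ℚ.*-monoˡ-<-pos ε (proj₂ arch) ⟩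
    ι N ℚ.* ε                     ≤⟨ ℚ.*-monoʳ-≤-nonNeg ε {{ℚ.pos⇒nonNeg ε}} (ι-mono-≤ N≤n) ⟩
    ι n ℚ.* ε                     ≡⟨ ℚ.*-comm (ι n) ε ⟩
    ε ℚ.* ι n                     ∎)
  where
  open ℚ.≤-Reasoning
  instance
    ε-pos : Positive ε
    ε-pos = ℚ.positive 0<ε
    ε-nz : ℚ.NonZero ε
    ε-nz = ℚ.pos⇒nonZero ε
  arch = archimedean (E ℚ.* (ℚ.1/ ε))
  N = proj₁ arch

Cauchy : (ℕ → ℚ) → Set
Cauchy x = ∀ ε → 0ℚ ℚ.< ε →
           ∃[ N ] ∀ m n → N ℕ.≤ m → N ℕ.≤ n → ℚ.∣ x m ℚ.- x n ∣ ℚ.< ε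

-- A real number is represented by any Cauchy sequence of rationals; two
-- representatives are equal when each is ≤ the other.
record ℝ : Set where
  constructor mkℝ
  field
    seq    : ℕ → ℚ
    cauchy : Cauchy seq

open ℝ public

-- The slack ε in _≤_ and the gap δ in _<_ make both relations independent of
-- the chosen representatives.
infix 4 _≤_ _<_

_≤_ : ℝ → ℝ → Set
x ≤ y = ∀ ε → 0ℚ ℚ.< ε → ∃[ N ] ∀ n → N ℕ.≤ n → seq x n ℚ.≤ seq y n ℚ.+ ε

_<_ : ℝ → ℝ → Set
x < y = ∃[ δ ] 0ℚ ℚ.< δ × ∃[ N ] ∀ n → N ℕ.≤ n → seq x n ℚ.+ δ ℚ.≤ seq y n

private
  half : ∀ {ε} → 0ℚ ℚ.< ε → 0ℚ ℚ.< ½ ℚ.* ε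
  half {ε} 0<ε = subst (ℚ._< ½ ℚ.* ε) (ℚ.*-zeroʳ ½) (ℚ.*-monoʳ-<-pos ½ 0<ε)

  half+half : ∀ ε → ½ ℚ.* ε ℚ.+ ½ ℚ.* ε ≡ ε
  half+half ε = trans (sym (ℚ.*-distribʳ-+ ε ½ ½)) (ℚ.*-identityˡ ε)

  ∣-∣-sym : ∀ p q → ℚ.∣ p ℚ.- q ∣ ≡ ℚ.∣ q ℚ.- p ∣
  ∣-∣-sym p q = trans (sym (ℚ.∣-p∣≡∣p∣ (p ℚ.- q)))
    (cong ℚ.∣_∣ (solve 2 (λ p q → :- (p :- q) := q :- p) refl p q))

  ∣-∣-triangle : ∀ p q r → ℚ.∣ p ℚ.- r ∣ ℚ.≤ ℚ.∣ p ℚ.- q ∣ ℚ.+ ℚ.∣ q ℚ.- r ∣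
  ∣-∣-triangle p q r = subst (λ s → ℚ.∣ s ∣ ℚ.≤ ℚ.∣ p ℚ.- q ∣ ℚ.+ ℚ.∣ q ℚ.- r ∣)
    (solve 3 (λ p q r → (p :- q) :+ (q :- r) := p :- r) refl p q r)
    (ℚ.∣p+q∣≤∣p∣+∣q∣ (p ℚ.- q) (q ℚ.- r))

  p≤∣p∣ : ∀ p → p ℚ.≤ ℚ.∣ p ∣
  p≤∣p∣ p with ℚ.≤-total 0ℚ p
  ... | inj₁ 0≤p = ℚ.≤-reflexive (sym (ℚ.0≤p⇒∣p∣≡p 0≤p))
  ... | inj₂ p≤0 = ℚ.≤-trans p≤0 (ℚ.0≤∣p∣ p)

  ∣p∣≤ : ∀ {p q} → p ℚ.≤ q → ℚ.- p ℚ.≤ q → ℚ.∣ p ∣ ℚ.≤ q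
  ∣p∣≤ {p} {q} p≤q -p≤q with ℚ.∣p∣≡p∨∣p∣≡-p p
  ... | inj₁ eq = subst (ℚ._≤ q) (sym eq) p≤q
  ... | inj₂ eq = subst (ℚ._≤ q) (sym eq) -p≤q

  ∣∣-∣∣≤ : ∀ p q → ℚ.∣ ℚ.∣ p ∣ ℚ.- ℚ.∣ q ∣ ∣ ℚ.≤ ℚ.∣ p ℚ.- q ∣
  ∣∣-∣∣≤ p q = ∣p∣≤ (oneSide p q) (subst₂ ℚ._≤_
    (solve 2 (λ a b → b :- a := :- (a :- b)) refl ℚ.∣ p ∣ ℚ.∣ q ∣) (∣-∣-sym q p) (oneSide q p))
    where
    oneSide : ∀ p q → ℚ.∣ p ∣ ℚ.- ℚ.∣ q ∣ ℚ.≤ ℚ.∣ p ℚ.- q ∣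
    oneSide p q = subst (ℚ.∣ p ∣ ℚ.- ℚ.∣ q ∣ ℚ.≤_)
      (solve 2 (λ a b → (a :+ b) :- b := a) refl ℚ.∣ p ℚ.- q ∣ ℚ.∣ q ∣)
      (ℚ.+-monoˡ-≤ (ℚ.- ℚ.∣ q ∣) (subst (λ s → ℚ.∣ s ∣ ℚ.≤ ℚ.∣ p ℚ.- q ∣ ℚ.+ ℚ.∣ q ∣)
        (solve 2 (λ p q → (p :- q) :+ q := p) refl p q) (ℚ.∣p+q∣≤∣p∣+∣q∣ (p ℚ.- q) q)))

fromℚ : ℚ → ℝ
fromℚ p = mkℝ (λ _ → p) λ ε 0<ε →
  0 , λ _ _ _ _ → subst (λ s → ℚ.∣ s ∣ ℚ.< ε) (sym (ℚ.+-inverseʳ p)) 0<ε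

fromℕ : ℕ → ℝ
fromℕ n = fromℚ (ι n)

1ℝ : ℝ
1ℝ = fromℚ 1ℚ

0ℝ : ℝ
0ℝ = fromℚ 0ℚ

infixl 6 _+_ _-_
infixl 7 _*_
infix  8 -_

_+_ : ℝ → ℝ → ℝ
x + y = mkℝ (λ n → seq x n ℚ.+ seq y n) λ ε 0<ε →
  let M , x-cauchy = cauchy x (½ ℚ.* ε) (half 0<ε)
      N , y-cauchy = cauchy y (½ ℚ.* ε) (half 0<ε)
  in M ℕ.⊔ N , λ m n ≤m ≤n → begin-strict
    ℚ.∣ (seq x m ℚ.+ seq y m) ℚ.- (seq x n ℚ.+ seq y n) ∣
      ≡⟨ cong ℚ.∣_∣ (solve 4 (λ a b c d → (a :+ b) :- (c :+ d) := (a :- c) :+ (b :- d)) refl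
           (seq x m) (seq y m) (seq x n) (seq y n)) ⟩
    ℚ.∣ (seq x m ℚ.- seq x n) ℚ.+ (seq y m ℚ.- seq y n) ∣
      ≤⟨ ℚ.∣p+q∣≤∣p∣+∣q∣ (seq x m ℚ.- seq x n) (seq y m ℚ.- seq y n) ⟩
    ℚ.∣ seq x m ℚ.- seq x n ∣ ℚ.+ ℚ.∣ seq y m ℚ.- seq y n ∣
      <⟨ ℚ.+-mono-< (x-cauchy m n (ℕ.m⊔n≤o⇒m≤o M N ≤m) (ℕ.m⊔n≤o⇒m≤o M N ≤n))
                    (y-cauchy m n (ℕ.m⊔n≤o⇒n≤o M N ≤m) (ℕ.m⊔n≤o⇒n≤o M N ≤n)) ⟩
    ½ ℚ.* ε ℚ.+ ½ ℚ.* ε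
      ≡⟨ half+half ε ⟩
    ε ∎
  where open ℚ.≤-Reasoning

-_ : ℝ → ℝ
- x = mkℝ (λ n → ℚ.- seq x n) λ ε 0<ε →
  let N , x-cauchy = cauchy x ε 0<ε
  in N , λ m n ≤m ≤n → subst (λ s → ℚ.∣ s ∣ ℚ.< ε)
       (solve 2 (λ a b → b :- a := :- a :- :- b) refl (seq x m) (seq x n))
       (x-cauchy n m ≤n ≤m)

_-_ : ℝ → ℝ → ℝ
x - y = x + (- y)

∣_∣ : ℝ → ℝ
∣ x ∣ = mkℝ (λ n → ℚ.∣ seq x n ∣) λ ε 0<ε →
  let N , x-cauchy = cauchy x ε 0<ε
  in N , λ m n ≤m ≤n → ℚ.≤-<-trans (∣∣-∣∣≤ (seq x m) (seq x n)) (x-cauchy m n ≤m ≤n)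

eventually-bounded : ∀ x → ∃[ B ] 0ℚ ℚ.< B × ∃[ N ] ∀ n → N ℕ.≤ n → ℚ.∣ seq x n ∣ ℚ.≤ B
eventually-bounded x =
  let N , x-cauchy = cauchy x 1ℚ (ι-mono-< {0} {1} z<s)
      B = 1ℚ ℚ.+ ℚ.∣ seq x N ∣
  in B , ℚ.+-mono-<-≤ (ι-mono-< {0} {1} z<s) (ℚ.0≤∣p∣ (seq x N)) , N , λ n N≤n → begin
    ℚ.∣ seq x n ∣
      ≡⟨ cong ℚ.∣_∣ (solve 2 (λ a b → a := (a :- b) :+ b) refl (seq x n) (seq x N)) ⟩
    ℚ.∣ (seq x n ℚ.- seq x N) ℚ.+ seq x N ∣
      ≤⟨ ℚ.∣p+q∣≤∣p∣+∣q∣ (seq x n ℚ.- seq x N) (seq x N) ⟩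
    ℚ.∣ seq x n ℚ.- seq x N ∣ ℚ.+ ℚ.∣ seq x N ∣
      ≤⟨ ℚ.+-monoˡ-≤ ℚ.∣ seq x N ∣ (ℚ.<⇒≤ (x-cauchy n N N≤n ℕ.≤-refl)) ⟩
    1ℚ ℚ.+ ℚ.∣ seq x N ∣ ∎
  where open ℚ.≤-Reasoning

private
  product-bound : ∀ ε {A p} a → (0<A : 0ℚ ℚ.< A) → ℚ.∣ a ∣ ℚ.≤ A →
    ℚ.∣ p ∣ ℚ.< ε ℚ.* (ℚ.1/ A) {{ℚ.>-nonZero 0<A}} → ℚ.∣ a ℚ.* p ∣ ℚ.≤ ε
  product-bound ε {A} {p} a 0<A a≤A p< = begin
    ℚ.∣ a ℚ.* p ∣          ≡⟨ ℚ.∣p*q∣≡∣p∣*∣q∣ a p ⟩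
    ℚ.∣ a ∣ ℚ.* ℚ.∣ p ∣    ≤⟨ ℚ.*-monoʳ-≤-nonNeg ℚ.∣ p ∣ {{ℚ.∣-∣-nonNeg p}} a≤A ⟩
    A ℚ.* ℚ.∣ p ∣          ≤⟨ ℚ.*-monoˡ-≤-nonNeg A {{ℚ.nonNegative (ℚ.<⇒≤ 0<A)}} (ℚ.<⇒≤ p<) ⟩
    A ℚ.* (ε ℚ.* (ℚ.1/ A)) ≡⟨ solve 3 (λ a e i → a :* (e :* i) := e :* (a :* i)) refl A ε (ℚ.1/ A) ⟩
    ε ℚ.* (A ℚ.* (ℚ.1/ A)) ≡⟨ cong (ε ℚ.*_) (ℚ.*-inverseʳ A) ⟩
    ε ℚ.* 1ℚ               ≡⟨ ℚ.*-identityʳ ε ⟩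
    ε                      ∎
    where
    open ℚ.≤-Reasoning
    instance
      A-nz : ℚ.NonZero A
      A-nz = ℚ.>-nonZero 0<A

  pos-÷ : ∀ {ε A} → 0ℚ ℚ.< ε → (0<A : 0ℚ ℚ.< A) → 0ℚ ℚ.< ε ℚ.* (ℚ.1/ A) {{ℚ.>-nonZero 0<A}}
  pos-÷ {ε} {A} 0<ε 0<A = ℚ.positive⁻¹ _ {{ℚ.pos*pos⇒pos ε {{ℚ.positive 0<ε}} ((ℚ.1/ A) {{ℚ.>-nonZero 0<A}}) {{ℚ.1/pos⇒pos A {{ℚ.positive 0<A}}}}}}

  quarter : ℚ → ℚ
  quarter ε = ½ ℚ.* (½ ℚ.* ε)

  halves< : ∀ {ε} → 0ℚ ℚ.< ε → quarter ε ℚ.+ quarter ε ℚ.< ε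
  halves< {ε} 0<ε = begin-strict
    quarter ε ℚ.+ quarter ε   ≡⟨ half+half (½ ℚ.* ε) ⟩
    ½ ℚ.* ε                   ≡⟨ ℚ.+-identityʳ (½ ℚ.* ε) ⟨
    ½ ℚ.* ε ℚ.+ 0ℚ            <⟨ ℚ.+-monoʳ-< (½ ℚ.* ε) (half 0<ε) ⟩
    ½ ℚ.* ε ℚ.+ ½ ℚ.* ε       ≡⟨ half+half ε ⟩
    ε                         ∎
    where open ℚ.≤-Reasoning

_*_ : ℝ → ℝ → ℝ
x * y = mkℝ (λ n → seq x n ℚ.* seq y n) λ ε 0<ε →
  let A , 0<A , M₁ , x≤A = eventually-bounded x
      B , 0<B , N₁ , y≤B = eventually-bounded y
      ε/4 = half (half 0<ε)
      M₂ , x-cauchy = cauchy x _ (pos-÷ ε/4 0<B)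
      N₂ , y-cauchy = cauchy y _ (pos-÷ ε/4 0<A)
      N = (M₁ ℕ.⊔ N₁) ℕ.⊔ (M₂ ℕ.⊔ N₂)
      M₁≤ : M₁ ℕ.≤ N
      M₁≤ = ℕ.≤-trans (ℕ.m≤m⊔n M₁ N₁) (ℕ.m≤m⊔n (M₁ ℕ.⊔ N₁) (M₂ ℕ.⊔ N₂))
      N₁≤ : N₁ ℕ.≤ N
      N₁≤ = ℕ.≤-trans (ℕ.m≤n⊔m M₁ N₁) (ℕ.m≤m⊔n (M₁ ℕ.⊔ N₁) (M₂ ℕ.⊔ N₂))
      M₂≤ : M₂ ℕ.≤ N
      M₂≤ = ℕ.≤-trans (ℕ.m≤m⊔n M₂ N₂) (ℕ.m≤n⊔m (M₁ ℕ.⊔ N₁) (M₂ ℕ.⊔ N₂))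
      N₂≤ : N₂ ℕ.≤ N
      N₂≤ = ℕ.≤-trans (ℕ.m≤n⊔m M₂ N₂) (ℕ.m≤n⊔m (M₁ ℕ.⊔ N₁) (M₂ ℕ.⊔ N₂))
  in N , λ m n ≤m ≤n → begin-strict
    ℚ.∣ seq x m ℚ.* seq y m ℚ.- seq x n ℚ.* seq y n ∣
      ≡⟨ cong ℚ.∣_∣ (solve 4 (λ a b c d → a :* b :- c :* d := a :* (b :- d) :+ d :* (a :- c)) refl
           (seq x m) (seq y m) (seq x n) (seq y n)) ⟩
    ℚ.∣ seq x m ℚ.* (seq y m ℚ.- seq y n) ℚ.+ seq y n ℚ.* (seq x m ℚ.- seq x n) ∣
      ≤⟨ ℚ.∣p+q∣≤∣p∣+∣q∣ (seq x m ℚ.* (seq y m ℚ.- seq y n)) (seq y n ℚ.* (seq x m ℚ.- seq x n)) ⟩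
    ℚ.∣ seq x m ℚ.* (seq y m ℚ.- seq y n) ∣ ℚ.+ ℚ.∣ seq y n ℚ.* (seq x m ℚ.- seq x n) ∣
      ≤⟨ ℚ.+-mono-≤
           (product-bound (quarter ε) (seq x m) 0<A (x≤A m (ℕ.≤-trans M₁≤ ≤m))
             (y-cauchy m n (ℕ.≤-trans N₂≤ ≤m) (ℕ.≤-trans N₂≤ ≤n)))
           (product-bound (quarter ε) (seq y n) 0<B (y≤B n (ℕ.≤-trans N₁≤ ≤n))
             (x-cauchy m n (ℕ.≤-trans M₂≤ ≤m) (ℕ.≤-trans M₂≤ ≤n))) ⟩
    quarter ε ℚ.+ quarter ε
      <⟨ halves< 0<ε ⟩
    ε ∎
  where open ℚ.≤-Reasoning

private
  cauchy-from-rate : ∀ x E → 0ℚ ℚ.≤ E →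
    (∀ m n → ℚ.∣ x m ℚ.- x n ∣ ℚ.≤ E ℚ.* (+ 1 ℚ./ suc m) ℚ.+ E ℚ.* (+ 1 ℚ./ suc n)) → Cauchy x
  cauchy-from-rate x E 0≤E rate ε 0<ε =
    let N , small = E/n→0 E 0≤E (½ ℚ.* ε) (half 0<ε)
    in N , λ m n N≤m N≤n → begin-strict
      ℚ.∣ x m ℚ.- x n ∣
        ≤⟨ rate m n ⟩
      E ℚ.* (+ 1 ℚ./ suc m) ℚ.+ E ℚ.* (+ 1 ℚ./ suc n)
        <⟨ ℚ.+-mono-< (small (suc m) (ℕ.m≤n⇒m≤1+n N≤m)) (small (suc n) (ℕ.m≤n⇒m≤1+n N≤n)) ⟩
      ½ ℚ.* ε ℚ.+ ½ ℚ.* ε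
        ≡⟨ half+half ε ⟩
      ε ∎
    where open ℚ.≤-Reasoning

isqrt : ℕ → ℕ
isqrt zero    = 0
isqrt (suc n) with suc (isqrt n) ℕ.* suc (isqrt n) ℕ.≤? suc n
... | yes _ = suc (isqrt n)
... | no  _ = isqrt n

isqrt-spec : ∀ n → isqrt n ℕ.* isqrt n ℕ.≤ n × n ℕ.< suc (isqrt n) ℕ.* suc (isqrt n)
isqrt-spec zero    = z≤n , z<s
isqrt-spec (suc n) with suc (isqrt n) ℕ.* suc (isqrt n) ℕ.≤? suc n | isqrt-spec n
... | yes p | _ , lt = p , ℕ.<-≤-trans (s≤s lt) (ℕ.*-mono-< {suc r} {suc (suc r)} {suc r} {suc (suc r)} ℕ.≤-refl ℕ.≤-refl)
  where r = isqrt n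
... | no ¬p | le , _ = ℕ.m≤n⇒m≤1+n le , ℕ.≰⇒> ¬p

private
  0≤1/ : ∀ m .{{_ : NonZero m}} → 0ℚ ℚ.≤ + 1 ℚ./ m
  0≤1/ m = ℚ.nonNegative⁻¹ (+ 1 ℚ./ m) {{ℚ.normalize-nonNeg 1 m}}

  square-cancel-< : ∀ m n → m ℕ.* m ℕ.< n ℕ.* n → m ℕ.< n
  square-cancel-< m n lt with m ℕ.<? n
  ... | yes m<n = m<n
  ... | no  m≮n = contradiction (ℕ.*-mono-≤ (ℕ.≮⇒≥ m≮n) (ℕ.≮⇒≥ m≮n)) (ℕ.<⇒≱ lt)

  *-interchange : ∀ a b c d → (a ℕ.* b) ℕ.* (c ℕ.* d) ≡ (a ℕ.* c) ℕ.* (b ℕ.* d)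
  *-interchange a b c d = trans (ℕ.*-assoc a b (c ℕ.* d)) (trans
    (cong (a ℕ.*_) (trans (sym (ℕ.*-assoc b c d)) (trans (cong (ℕ._* d) (ℕ.*-comm b c)) (ℕ.*-assoc c b d))))
    (sym (ℕ.*-assoc a c (b ℕ.* d))))

-- ⌊ √ (n m²) ⌋ / m, which lies within 1/m of √ n.
√-approx : ℕ → (m : ℕ) .{{_ : NonZero m}} → ℚ
√-approx n m = + isqrt (n ℕ.* (m ℕ.* m)) ℚ./ m

private
  √-approx-close : ∀ n m k .{{_ : NonZero m}} .{{_ : NonZero k}} →
                   √-approx n m ℚ.≤ √-approx n k ℚ.+ (+ 1 ℚ./ k)
  √-approx-close n m@(suc _) k@(suc _) = ℚ.*-cancelʳ-≤-pos (ι m ℚ.* ι k) {{pos}} (begin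
    R ℚ.* (ι m ℚ.* ι k)             ≡⟨ ℚ.*-assoc R (ι m) (ι k) ⟨
    R ℚ.* ι m ℚ.* ι k               ≡⟨ cong (ℚ._* ι k) (/-ι r m) ⟩
    ι r ℚ.* ι k                     ≡⟨ ι-* r k ⟨
    ι (r ℕ.* k)                     ≤⟨ ι-mono-≤ (ℕ.<⇒≤ rk<) ⟩
    ι (suc s ℕ.* m)                 ≡⟨ ι-* (suc s) m ⟩
    ι (suc s) ℚ.* ι m               ≡⟨ cong (ℚ._* ι m) (ι-+ 1 s) ⟩
    (1ℚ ℚ.+ ι s) ℚ.* ι m            ≡⟨ cong (ℚ._* ι m) (cong₂ ℚ._+_ (/-ι 1 k) (/-ι s k)) ⟨
    ((+ 1 ℚ./ k) ℚ.* ι k ℚ.+ S ℚ.* ι k) ℚ.* ι m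
      ≡⟨ solve 4 (λ i k s m → (i :* k :+ s :* k) :* m := (s :+ i) :* (m :* k)) refl
           (+ 1 ℚ./ k) (ι k) S (ι m) ⟩
    (S ℚ.+ (+ 1 ℚ./ k)) ℚ.* (ι m ℚ.* ι k) ∎)
    where
    open ℚ.≤-Reasoning
    r = isqrt (n ℕ.* (m ℕ.* m))
    s = isqrt (n ℕ.* (k ℕ.* k))
    R = √-approx n m
    S = √-approx n k
    pos : Positive (ι m ℚ.* ι k)
    pos = subst Positive (ι-* m k) (ℚ.positive (ι-mono-< {0} {m ℕ.* k} z<s))
    rk< : r ℕ.* k ℕ.< suc s ℕ.* m
    rk< = square-cancel-< (r ℕ.* k) (suc s ℕ.* m) (subst₂ ℕ._<_
            (*-interchange r r k k) (*-interchange (suc s) (suc s) m m)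
            (ℕ.≤-<-trans (ℕ.*-monoˡ-≤ (k ℕ.* k) (proj₁ (isqrt-spec (n ℕ.* (m ℕ.* m)))))
              (subst (ℕ._< suc s ℕ.* suc s ℕ.* (m ℕ.* m)) swap
                (ℕ.*-monoˡ-< (m ℕ.* m) (proj₂ (isqrt-spec (n ℕ.* (k ℕ.* k))))))))
      where
      swap : n ℕ.* (k ℕ.* k) ℕ.* (m ℕ.* m) ≡ n ℕ.* (m ℕ.* m) ℕ.* (k ℕ.* k)
      swap = trans (ℕ.*-assoc n _ _) (trans (cong (n ℕ.*_) (ℕ.*-comm (k ℕ.* k) _)) (sym (ℕ.*-assoc n _ _)))

√_ : ℕ → ℝ
√ n = mkℝ (λ k → √-approx n (suc k)) (cauchy-from-rate (λ k → √-approx n (suc k)) 1ℚ (0≤ι 1) rate)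
  where
  open ℚ.≤-Reasoning
  shift : ∀ {p q r t} → 0ℚ ℚ.≤ t → p ℚ.≤ q ℚ.+ r → p ℚ.- q ℚ.≤ r ℚ.+ t
  shift {p} {q} {r} {t} 0≤t p≤q+r = begin
    p ℚ.- q          ≤⟨ ℚ.+-monoˡ-≤ (ℚ.- q) p≤q+r ⟩
    q ℚ.+ r ℚ.- q    ≡⟨ solve 2 (λ q r → q :+ r :- q := r) refl q r ⟩
    r                ≡⟨ ℚ.+-identityʳ r ⟨
    r ℚ.+ 0ℚ         ≤⟨ ℚ.+-monoʳ-≤ r 0≤t ⟩
    r ℚ.+ t          ∎
  rate : ∀ m k → ℚ.∣ √-approx n (suc m) ℚ.- √-approx n (suc k) ∣ ℚ.≤
                 1ℚ ℚ.* (+ 1 ℚ./ suc m) ℚ.+ 1ℚ ℚ.* (+ 1 ℚ./ suc k)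
  rate m k = subst₂ (λ a b → ℚ.∣ R ℚ.- S ∣ ℚ.≤ a ℚ.+ b) (sym (ℚ.*-identityˡ (+ 1 ℚ./ suc m))) (sym (ℚ.*-identityˡ (+ 1 ℚ./ suc k)))
    (∣p∣≤ (subst (R ℚ.- S ℚ.≤_) (ℚ.+-comm (+ 1 ℚ./ suc k) (+ 1 ℚ./ suc m))
             (shift {R} {S} (0≤1/ (suc m)) (√-approx-close n (suc m) (suc k))))
          (subst (ℚ._≤ (+ 1 ℚ./ suc m) ℚ.+ (+ 1 ℚ./ suc k))
             (solve 2 (λ r s → s :- r := :- (r :- s)) refl R S)
             (shift {S} {R} (0≤1/ (suc k)) (√-approx-close n (suc k) (suc m)))))
    where
    R = √-approx n (suc m)
    S = √-approx n (suc k)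

-- ∑ g n  =  g 0 + ⋯ + g (n - 1)
∑ : (ℕ → ℚ) → ℕ → ℚ
∑ g zero    = 0ℚ
∑ g (suc n) = ∑ g n ℚ.+ g n

∑-const : ∀ c n → ∑ (λ _ → c) n ≡ ι n ℚ.* c
∑-const c zero    = sym (ℚ.*-zeroˡ c)
∑-const c (suc n) = begin
  ∑ (λ _ → c) n ℚ.+ c       ≡⟨ cong (ℚ._+ c) (∑-const c n) ⟩
  ι n ℚ.* c ℚ.+ c           ≡⟨ solve 2 (λ a c → a :* c :+ c := (con 1ℚ :+ a) :* c) refl (ι n) c ⟩
  (1ℚ ℚ.+ ι n) ℚ.* c        ≡⟨ cong (ℚ._* c) (ι-+ 1 n) ⟨
  ι (suc n) ℚ.* c           ∎
  where open ≡-Reasoning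

∑-+ : ∀ g m n → ∑ g (m ℕ.+ n) ≡ ∑ g m ℚ.+ ∑ (λ j → g (m ℕ.+ j)) n
∑-+ g m zero    = trans (cong (∑ g) (ℕ.+-identityʳ m)) (sym (ℚ.+-identityʳ (∑ g m)))
∑-+ g m (suc n) = trans (cong (∑ g) (ℕ.+-suc m n)) (trans
  (cong (ℚ._+ g (m ℕ.+ n)) (∑-+ g m n)) (ℚ.+-assoc (∑ g m) _ _))

∑-* : ∀ g m n → ∑ g (m ℕ.* n) ≡ ∑ (λ i → ∑ (λ j → g (i ℕ.* n ℕ.+ j)) n) m
∑-* g zero    n = refl
∑-* g (suc m) n = trans (cong (∑ g) (ℕ.+-comm n (m ℕ.* n))) (trans
  (∑-+ g (m ℕ.* n) n) (cong (ℚ._+ ∑ (λ j → g (m ℕ.* n ℕ.+ j)) n) (∑-* g m n)))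

∑-close : ∀ g h B n → (∀ i → i ℕ.< n → ℚ.∣ g i ℚ.- h i ∣ ℚ.≤ B) →
          ℚ.∣ ∑ g n ℚ.- ∑ h n ∣ ℚ.≤ ι n ℚ.* B
∑-close g h B zero    close = ℚ.≤-reflexive (sym (ℚ.*-zeroˡ B))
∑-close g h B (suc n) close = begin
  ℚ.∣ ∑ g n ℚ.+ g n ℚ.- (∑ h n ℚ.+ h n) ∣
    ≡⟨ cong ℚ.∣_∣ (solve 4 (λ a b c d → (a :+ b) :- (c :+ d) := (a :- c) :+ (b :- d)) refl
         (∑ g n) (g n) (∑ h n) (h n)) ⟩
  ℚ.∣ (∑ g n ℚ.- ∑ h n) ℚ.+ (g n ℚ.- h n) ∣
    ≤⟨ ℚ.∣p+q∣≤∣p∣+∣q∣ (∑ g n ℚ.- ∑ h n) (g n ℚ.- h n) ⟩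
  ℚ.∣ ∑ g n ℚ.- ∑ h n ∣ ℚ.+ ℚ.∣ g n ℚ.- h n ∣
    ≤⟨ ℚ.+-mono-≤ (∑-close g h B n (λ i i<n → close i (ℕ.m≤n⇒m≤1+n i<n))) (close n ℕ.≤-refl) ⟩
  ι n ℚ.* B ℚ.+ B
    ≡⟨ solve 2 (λ a c → a :* c :+ c := (con 1ℚ :+ a) :* c) refl (ι n) B ⟩
  (1ℚ ℚ.+ ι n) ℚ.* B
    ≡⟨ cong (ℚ._* B) (ι-+ 1 n) ⟨
  ι (suc n) ℚ.* B ∎
  where open ℚ.≤-Reasoning

-- The closed interval with end points a and b, in either order.
_∈[_,_] : ℚ → ℚ → ℚ → Set
x ∈[ a , b ] = a ℚ.⊓ b ℚ.≤ x × x ℚ.≤ a ℚ.⊔ b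

Lipschitz : (ℚ → ℚ) → ℚ → ℚ → ℚ → Set
Lipschitz f a b K = ∀ x y → x ∈[ a , b ] → y ∈[ a , b ] →
                    ℚ.∣ f x ℚ.- f y ∣ ℚ.≤ K ℚ.* ℚ.∣ x ℚ.- y ∣

-- Right-endpoint Riemann sum of f from a to b with m equal steps;
-- the step is negative when b < a.
step : ℚ → ℚ → (m : ℕ) .{{_ : NonZero m}} → ℚ
step a b m = (b ℚ.- a) ℚ.* (+ 1 ℚ./ m)

riemannSum : (ℚ → ℚ) → ℚ → ℚ → (m : ℕ) .{{_ : NonZero m}} → ℚ
riemannSum f a b m = ∑ (λ i → f (a ℚ.+ ι (suc i) ℚ.* step a b m) ℚ.* step a b m) m

private
  1/m≡n/mn : ∀ m n .{{_ : NonZero m}} .{{_ : NonZero n}} .{{_ : NonZero (m ℕ.* n)}} →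
             + 1 ℚ./ m ≡ ι n ℚ.* (+ 1 ℚ./ (m ℕ.* n))
  1/m≡n/mn m n = begin
    u                               ≡⟨ ℚ.*-identityʳ u ⟨
    u ℚ.* 1ℚ                        ≡⟨ cong (u ℚ.*_) (/-ι 1 (m ℕ.* n)) ⟨
    u ℚ.* (v ℚ.* ι (m ℕ.* n))       ≡⟨ cong (λ z → u ℚ.* (v ℚ.* z)) (ι-* m n) ⟩
    u ℚ.* (v ℚ.* (ι m ℚ.* ι n))     ≡⟨ solve 4 (λ u v m n → u :* (v :* (m :* n)) := (u :* m) :* (n :* v)) refl
                                         u v (ι m) (ι n) ⟩
    (u ℚ.* ι m) ℚ.* (ι n ℚ.* v)     ≡⟨ cong (ℚ._* (ι n ℚ.* v)) (/-ι 1 m) ⟩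
    1ℚ ℚ.* (ι n ℚ.* v)              ≡⟨ ℚ.*-identityˡ (ι n ℚ.* v) ⟩
    ι n ℚ.* v                       ∎
    where
    open ≡-Reasoning
    u = + 1 ℚ./ m
    v = + 1 ℚ./ (m ℕ.* n)

  convex : ∀ a b θ → 0ℚ ℚ.≤ θ → θ ℚ.≤ 1ℚ → (a ℚ.+ θ ℚ.* (b ℚ.- a)) ∈[ a , b ]
  convex a b θ 0≤θ θ≤1 =
    subst₂ ℚ._≤_ (same (a ℚ.⊓ b)) mix
      (ℚ.+-mono-≤ (ℚ.*-monoˡ-≤-nonNeg (1ℚ ℚ.- θ) (ℚ.p⊓q≤p a b)) (ℚ.*-monoˡ-≤-nonNeg θ (ℚ.p⊓q≤q a b))) ,
    subst₂ ℚ._≤_ mix (same (a ℚ.⊔ b))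
      (ℚ.+-mono-≤ (ℚ.*-monoˡ-≤-nonNeg (1ℚ ℚ.- θ) (ℚ.p≤p⊔q a b)) (ℚ.*-monoˡ-≤-nonNeg θ (ℚ.p≤q⊔p a b)))
    where
    instance
      θ-nonNeg : ℚ.NonNegative θ
      θ-nonNeg = ℚ.nonNegative 0≤θ
      1-θ-nonNeg : ℚ.NonNegative (1ℚ ℚ.- θ)
      1-θ-nonNeg = ℚ.nonNegative (subst (ℚ._≤ 1ℚ ℚ.- θ) (ℚ.+-inverseʳ θ) (ℚ.+-monoˡ-≤ (ℚ.- θ) θ≤1))
    same : ∀ c → (1ℚ ℚ.- θ) ℚ.* c ℚ.+ θ ℚ.* c ≡ c
    same c = solve 2 (λ t c → (con 1ℚ :- t) :* c :+ t :* c := c) refl θ c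
    mix : (1ℚ ℚ.- θ) ℚ.* a ℚ.+ θ ℚ.* b ≡ a ℚ.+ θ ℚ.* (b ℚ.- a)
    mix = solve 3 (λ t a b → (con 1ℚ :- t) :* a :+ t :* b := a :+ t :* (b :- a)) refl θ a b

  node-∈ : ∀ a b k m .{{_ : NonZero m}} → k ℕ.≤ m → (a ℚ.+ ι k ℚ.* step a b m) ∈[ a , b ]
  node-∈ a b k m k≤m = subst (_∈[ a , b ]) eq (convex a b (ι k ℚ.* u) 0≤θ θ≤1)
    where
    u = + 1 ℚ./ m
    instance
      u-nonNeg : ℚ.NonNegative u
      u-nonNeg = ℚ.nonNegative (0≤1/ m)
    eq : a ℚ.+ ι k ℚ.* u ℚ.* (b ℚ.- a) ≡ a ℚ.+ ι k ℚ.* step a b m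
    eq = cong (a ℚ.+_) (solve 3 (λ k u d → k :* u :* d := k :* (d :* u)) refl (ι k) u (b ℚ.- a))
    0≤θ : 0ℚ ℚ.≤ ι k ℚ.* u
    0≤θ = subst (ℚ._≤ ι k ℚ.* u) (ℚ.*-zeroˡ u) (ℚ.*-monoʳ-≤-nonNeg u (0≤ι k))
    θ≤1 : ι k ℚ.* u ℚ.≤ 1ℚ
    θ≤1 = subst (ι k ℚ.* u ℚ.≤_) (trans (ℚ.*-comm (ι m) u) (/-ι 1 m))
            (ℚ.*-monoʳ-≤-nonNeg u (ι-mono-≤ k≤m))

  riemannSum-cong : ∀ f a b {m n} .{{_ : NonZero m}} .{{_ : NonZero n}} → m ≡ n →
                    riemannSum f a b m ≡ riemannSum f a b n
  riemannSum-cong f a b refl = refl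

  index : ∀ n i j → j ℕ.< n → suc i ℕ.* n ≡ suc (i ℕ.* n ℕ.+ j) ℕ.+ (n ℕ.∸ suc j)
  index n i j j<n = begin-equality
    n ℕ.+ i ℕ.* n                                 ≡⟨ ℕ.+-comm n (i ℕ.* n) ⟩
    i ℕ.* n ℕ.+ n                                 ≡⟨ cong (i ℕ.* n ℕ.+_) (ℕ.m+[n∸m]≡n j<n) ⟨
    i ℕ.* n ℕ.+ (suc j ℕ.+ (n ℕ.∸ suc j))         ≡⟨ ℕ.+-assoc (i ℕ.* n) (suc j) (n ℕ.∸ suc j) ⟨
    i ℕ.* n ℕ.+ suc j ℕ.+ (n ℕ.∸ suc j)           ≡⟨ cong (ℕ._+ (n ℕ.∸ suc j)) (ℕ.+-suc (i ℕ.* n) j) ⟩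
    suc (i ℕ.* n ℕ.+ j) ℕ.+ (n ℕ.∸ suc j)         ∎
    where open ℕ.≤-Reasoning

  refinement : ∀ f a b K → 0ℚ ℚ.≤ K → Lipschitz f a b K →
    ∀ m n .{{_ : NonZero m}} .{{_ : NonZero n}} .{{_ : NonZero (m ℕ.* n)}} →
    ℚ.∣ riemannSum f a b m ℚ.- riemannSum f a b (m ℕ.* n) ∣ ℚ.≤
    K ℚ.* (ℚ.∣ b ℚ.- a ∣ ℚ.* ℚ.∣ b ℚ.- a ∣) ℚ.* (+ 1 ℚ./ m)
  refinement f a b K 0≤K lip m n = begin
    ℚ.∣ riemannSum f a b m ℚ.- ∑ fine (m ℕ.* n) ∣
      ≡⟨ cong₂ (λ p q → ℚ.∣ p ℚ.- q ∣)
           (cong (λ s → ∑ (λ i → f (a ℚ.+ ι (suc i) ℚ.* s) ℚ.* s) m) step≡) (∑-* fine m n) ⟩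
    ℚ.∣ ∑ coarse m ℚ.- ∑ (λ i → ∑ (λ j → fine (i ℕ.* n ℕ.+ j)) n) m ∣
      ≤⟨ ∑-close coarse (λ i → ∑ (λ j → fine (i ℕ.* n ℕ.+ j)) n) (ι n ℚ.* B) m block ⟩
    ι m ℚ.* (ι n ℚ.* B)
      ≡⟨ total ⟩
    K ℚ.* (d ℚ.* d) ℚ.* (+ 1 ℚ./ m) ∎
    where
    open ℚ.≤-Reasoning
    d = ℚ.∣ b ℚ.- a ∣
    h = step a b (m ℕ.* n)
    H = ι n ℚ.* h
    u = + 1 ℚ./ (m ℕ.* n)
    B = K ℚ.* (ι n ℚ.* ℚ.∣ h ∣) ℚ.* ℚ.∣ h ∣
    coarse fine : ℕ → ℚ
    coarse i = f (a ℚ.+ ι (suc i) ℚ.* H) ℚ.* H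
    fine   k = f (a ℚ.+ ι (suc k) ℚ.* h) ℚ.* h

    step≡ : step a b m ≡ H
    step≡ = trans (cong ((b ℚ.- a) ℚ.*_) (1/m≡n/mn m n))
      (solve 3 (λ d n u → d :* (n :* u) := n :* (d :* u)) refl (b ℚ.- a) (ι n) u)

    ∣h∣≡ : ℚ.∣ h ∣ ≡ d ℚ.* u
    ∣h∣≡ = trans (ℚ.∣p*q∣≡∣p∣*∣q∣ (b ℚ.- a) u) (cong (d ℚ.*_) (ℚ.0≤p⇒∣p∣≡p (0≤1/ (m ℕ.* n))))

    total : ι m ℚ.* (ι n ℚ.* B) ≡ K ℚ.* (d ℚ.* d) ℚ.* (+ 1 ℚ./ m)
    total = begin-equality
      ι m ℚ.* (ι n ℚ.* B)
        ≡⟨ cong (λ z → ι m ℚ.* (ι n ℚ.* (K ℚ.* (ι n ℚ.* z) ℚ.* z))) ∣h∣≡ ⟩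
      ι m ℚ.* (ι n ℚ.* (K ℚ.* (ι n ℚ.* (d ℚ.* u)) ℚ.* (d ℚ.* u)))
        ≡⟨ solve 5 (λ m n k d u → m :* (n :* (k :* (n :* (d :* u)) :* (d :* u)))
                               := (u :* (m :* n)) :* (k :* (d :* d) :* (n :* u))) refl
             (ι m) (ι n) K d u ⟩
      (u ℚ.* (ι m ℚ.* ι n)) ℚ.* (K ℚ.* (d ℚ.* d) ℚ.* (ι n ℚ.* u))
        ≡⟨ cong₂ ℚ._*_ (trans (cong (u ℚ.*_) (sym (ι-* m n))) (/-ι 1 (m ℕ.* n)))
             (cong (K ℚ.* (d ℚ.* d) ℚ.*_) (sym (1/m≡n/mn m n))) ⟩
      1ℚ ℚ.* (K ℚ.* (d ℚ.* d) ℚ.* (+ 1 ℚ./ m))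
        ≡⟨ ℚ.*-identityˡ (K ℚ.* (d ℚ.* d) ℚ.* (+ 1 ℚ./ m)) ⟩
      K ℚ.* (d ℚ.* d) ℚ.* (+ 1 ℚ./ m) ∎

    fine-∈ : ∀ i j → i ℕ.< m → j ℕ.< n → (a ℚ.+ ι (suc (i ℕ.* n ℕ.+ j)) ℚ.* h) ∈[ a , b ]
    fine-∈ i j i<m j<n = node-∈ a b (suc (i ℕ.* n ℕ.+ j)) (m ℕ.* n) (ℕ.≤-trans
      (subst (suc (i ℕ.* n ℕ.+ j) ℕ.≤_) (sym (index n i j j<n)) (ℕ.m≤m+n _ (n ℕ.∸ suc j)))
      (ℕ.*-monoˡ-≤ n i<m))

    coarse-∈ : ∀ i → i ℕ.< m → (a ℚ.+ ι (suc i) ℚ.* H) ∈[ a , b ]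
    coarse-∈ i i<m = subst (λ s → (a ℚ.+ ι (suc i) ℚ.* s) ∈[ a , b ]) step≡ (node-∈ a b (suc i) m i<m)

    distance : ∀ i j → j ℕ.< n →
      ℚ.∣ (a ℚ.+ ι (suc i) ℚ.* H) ℚ.- (a ℚ.+ ι (suc (i ℕ.* n ℕ.+ j)) ℚ.* h) ∣ ℚ.≤ ι n ℚ.* ℚ.∣ h ∣
    distance i j j<n = begin
      ℚ.∣ (a ℚ.+ ι (suc i) ℚ.* H) ℚ.- (a ℚ.+ ι k ℚ.* h) ∣
        ≡⟨ cong ℚ.∣_∣ (solve 5 (λ a i n k h → (a :+ i :* (n :* h)) :- (a :+ k :* h) := (i :* n :- k) :* h)
             refl a (ι (suc i)) (ι n) (ι k) h) ⟩
      ℚ.∣ (ι (suc i) ℚ.* ι n ℚ.- ι k) ℚ.* h ∣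
        ≡⟨ cong (λ z → ℚ.∣ (z ℚ.- ι k) ℚ.* h ∣)
             (trans (sym (ι-* (suc i) n)) (trans (cong ι (index n i j j<n)) (ι-+ k r))) ⟩
      ℚ.∣ (ι k ℚ.+ ι r ℚ.- ι k) ℚ.* h ∣
        ≡⟨ cong ℚ.∣_∣ (solve 3 (λ k r h → (k :+ r :- k) :* h := r :* h) refl (ι k) (ι r) h) ⟩
      ℚ.∣ ι r ℚ.* h ∣
        ≡⟨ trans (ℚ.∣p*q∣≡∣p∣*∣q∣ (ι r) h) (cong (ℚ._* ℚ.∣ h ∣) (ℚ.0≤p⇒∣p∣≡p (0≤ι r))) ⟩
      ι r ℚ.* ℚ.∣ h ∣
        ≤⟨ ℚ.*-monoʳ-≤-nonNeg ℚ.∣ h ∣ {{ℚ.∣-∣-nonNeg h}} (ι-mono-≤ (ℕ.m∸n≤m n (suc j))) ⟩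
      ι n ℚ.* ℚ.∣ h ∣ ∎
      where
      k = suc (i ℕ.* n ℕ.+ j)
      r = n ℕ.∸ suc j

    block : ∀ i → i ℕ.< m → ℚ.∣ coarse i ℚ.- ∑ (λ j → fine (i ℕ.* n ℕ.+ j)) n ∣ ℚ.≤ ι n ℚ.* B
    block i i<m = subst (λ z → ℚ.∣ z ℚ.- ∑ (λ j → fine (i ℕ.* n ℕ.+ j)) n ∣ ℚ.≤ ι n ℚ.* B)
      (trans (∑-const (f X ℚ.* h) n) (solve 3 (λ n x h → n :* (x :* h) := x :* (n :* h)) refl (ι n) (f X) h))
      (∑-close (λ _ → f X ℚ.* h) (λ j → fine (i ℕ.* n ℕ.+ j)) B n λ j j<n → begin
        ℚ.∣ f X ℚ.* h ℚ.- f (Y j) ℚ.* h ∣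
          ≡⟨ cong ℚ.∣_∣ (solve 3 (λ x y h → x :* h :- y :* h := (x :- y) :* h) refl (f X) (f (Y j)) h) ⟩
        ℚ.∣ (f X ℚ.- f (Y j)) ℚ.* h ∣
          ≡⟨ ℚ.∣p*q∣≡∣p∣*∣q∣ (f X ℚ.- f (Y j)) h ⟩
        ℚ.∣ f X ℚ.- f (Y j) ∣ ℚ.* ℚ.∣ h ∣
          ≤⟨ ℚ.*-monoʳ-≤-nonNeg ℚ.∣ h ∣ {{ℚ.∣-∣-nonNeg h}} (ℚ.≤-trans
               (lip X (Y j) (coarse-∈ i i<m) (fine-∈ i j i<m j<n))
               (ℚ.*-monoˡ-≤-nonNeg K {{ℚ.nonNegative 0≤K}} (distance i j j<n))) ⟩
        B ∎)
      where
      X = a ℚ.+ ι (suc i) ℚ.* H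
      Y : ℕ → ℚ
      Y j = a ℚ.+ ι (suc (i ℕ.* n ℕ.+ j)) ℚ.* h

-- The integral of f from a to b (negated when b < a); K serves only to prove
-- that the Riemann sums converge.
integral : ∀ f a b K → 0ℚ ℚ.≤ K → Lipschitz f a b K → ℝ
integral f a b K 0≤K lip = mkℝ R (cauchy-from-rate R E 0≤E rate)
  where
  open ℚ.≤-Reasoning
  R : ℕ → ℚ
  R m = riemannSum f a b (suc m)
  d = ℚ.∣ b ℚ.- a ∣
  E = K ℚ.* (d ℚ.* d)
  0≤E : 0ℚ ℚ.≤ E
  0≤E = ℚ.nonNegative⁻¹ E {{ℚ.nonNeg*nonNeg⇒nonNeg K {{ℚ.nonNegative 0≤K}} (d ℚ.* d)
          {{ℚ.nonNeg*nonNeg⇒nonNeg d {{ℚ.∣-∣-nonNeg (b ℚ.- a)}} d {{ℚ.∣-∣-nonNeg (b ℚ.- a)}}}}}}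
  rate : ∀ m n → ℚ.∣ R m ℚ.- R n ∣ ℚ.≤ E ℚ.* (+ 1 ℚ./ suc m) ℚ.+ E ℚ.* (+ 1 ℚ./ suc n)
  rate m n = begin
    ℚ.∣ R m ℚ.- R n ∣
      ≤⟨ ∣-∣-triangle (R m) C (R n) ⟩
    ℚ.∣ R m ℚ.- C ∣ ℚ.+ ℚ.∣ C ℚ.- R n ∣
      ≡⟨ cong (ℚ.∣ R m ℚ.- C ∣ ℚ.+_) (trans (∣-∣-sym C (R n))
           (cong (λ z → ℚ.∣ R n ℚ.- z ∣) (riemannSum-cong f a b (ℕ.*-comm (suc m) (suc n))))) ⟩
    ℚ.∣ R m ℚ.- C ∣ ℚ.+ ℚ.∣ R n ℚ.- riemannSum f a b (suc n ℕ.* suc m) ∣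
      ≤⟨ ℚ.+-mono-≤ (refinement f a b K 0≤K lip (suc m) (suc n)) (refinement f a b K 0≤K lip (suc n) (suc m)) ⟩
    E ℚ.* (+ 1 ℚ./ suc m) ℚ.+ E ℚ.* (+ 1 ℚ./ suc n) ∎
    where C = riemannSum f a b (suc m ℕ.* suc n)

-- t ↦ 1/t, extended by the value 0 at t = 0, which is never reached below.
recip : ℚ → ℚ
recip p with p ℚ.≟ 0ℚ
... | yes _   = 0ℚ
... | no  p≢0 = (ℚ.1/ p) {{ℚ.≢-nonZero p≢0}}

*-recip : ∀ p → 0ℚ ℚ.< p → p ℚ.* recip p ≡ 1ℚ
*-recip p 0<p with p ℚ.≟ 0ℚ
... | yes p≡0 = contradiction (sym p≡0) (ℚ.<⇒≢ 0<p)
... | no  p≢0 = ℚ.*-inverseʳ p {{ℚ.≢-nonZero p≢0}}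

private
  recip-nonNeg : ∀ p → 0ℚ ℚ.< p → ℚ.NonNegative (recip p)
  recip-nonNeg p 0<p = ℚ.nonNegative (ℚ.*-cancelˡ-≤-pos p {{ℚ.positive 0<p}}
    (subst₂ ℚ._≤_ (sym (ℚ.*-zeroʳ p)) (sym (*-recip p 0<p)) (0≤ι 1)))

  recip-antimono : ∀ {c p} → 0ℚ ℚ.< c → c ℚ.≤ p → recip p ℚ.≤ recip c
  recip-antimono {c} {p} 0<c c≤p = begin
    recip p                            ≡⟨ ℚ.*-identityʳ (recip p) ⟨
    recip p ℚ.* 1ℚ                     ≡⟨ cong (recip p ℚ.*_) (*-recip c 0<c) ⟨
    recip p ℚ.* (c ℚ.* recip c)        ≤⟨ ℚ.*-monoˡ-≤-nonNeg (recip p) {{recip-nonNeg p 0<p}}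
                                            (ℚ.*-monoʳ-≤-nonNeg (recip c) {{recip-nonNeg c 0<c}} c≤p) ⟩
    recip p ℚ.* (p ℚ.* recip c)        ≡⟨ solve 3 (λ r p s → r :* (p :* s) := (p :* r) :* s) refl
                                            (recip p) p (recip c) ⟩
    (p ℚ.* recip p) ℚ.* recip c        ≡⟨ cong (ℚ._* recip c) (*-recip p 0<p) ⟩
    1ℚ ℚ.* recip c                     ≡⟨ ℚ.*-identityˡ (recip c) ⟩
    recip c                            ∎
    where
    open ℚ.≤-Reasoning
    0<p = ℚ.<-≤-trans 0<c c≤p

  recip-lipschitz : ∀ a b → 0ℚ ℚ.< a ℚ.⊓ b →
    Lipschitz recip a b (recip (a ℚ.⊓ b) ℚ.* recip (a ℚ.⊓ b))
  recip-lipschitz a b 0<c x y (c≤x , _) (c≤y , _) = begin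
    ℚ.∣ r ℚ.- s ∣
      ≡⟨ cong ℚ.∣_∣ (begin-equality
           r ℚ.- s                                  ≡⟨ cong₂ ℚ._-_ (ℚ.*-identityˡ r) (ℚ.*-identityˡ s) ⟨
           1ℚ ℚ.* r ℚ.- 1ℚ ℚ.* s                    ≡⟨ cong₂ (λ u v → u ℚ.* r ℚ.- v ℚ.* s) (*-recip y 0<y) (*-recip x 0<x) ⟨
           y ℚ.* s ℚ.* r ℚ.- x ℚ.* r ℚ.* s          ≡⟨ solve 4 (λ x y r s → y :* s :* r :- x :* r :* s := (r :* s) :* (y :- x))
                                                          refl x y r s ⟩
           (r ℚ.* s) ℚ.* (y ℚ.- x)                  ∎) ⟩
    ℚ.∣ (r ℚ.* s) ℚ.* (y ℚ.- x) ∣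
      ≡⟨ ℚ.∣p*q∣≡∣p∣*∣q∣ (r ℚ.* s) (y ℚ.- x) ⟩
    ℚ.∣ r ℚ.* s ∣ ℚ.* ℚ.∣ y ℚ.- x ∣
      ≡⟨ cong₂ ℚ._*_ (ℚ.0≤p⇒∣p∣≡p (ℚ.nonNegative⁻¹ (r ℚ.* s)
           {{ℚ.nonNeg*nonNeg⇒nonNeg r {{r-nonNeg}} s {{s-nonNeg}}}})) (∣-∣-sym y x) ⟩
    r ℚ.* s ℚ.* ℚ.∣ x ℚ.- y ∣
      ≤⟨ ℚ.*-monoʳ-≤-nonNeg ℚ.∣ x ℚ.- y ∣ {{ℚ.∣-∣-nonNeg (x ℚ.- y)}} (ℚ.≤-trans
           (ℚ.*-monoʳ-≤-nonNeg s {{s-nonNeg}} (recip-antimono 0<c c≤x))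
           (ℚ.*-monoˡ-≤-nonNeg (recip c) {{recip-nonNeg c 0<c}} (recip-antimono 0<c c≤y))) ⟩
    recip c ℚ.* recip c ℚ.* ℚ.∣ x ℚ.- y ∣ ∎
    where
    open ℚ.≤-Reasoning
    c = a ℚ.⊓ b
    r = recip x
    s = recip y
    0<x = ℚ.<-≤-trans 0<c c≤x
    0<y = ℚ.<-≤-trans 0<c c≤y
    r-nonNeg = recip-nonNeg x 0<x
    s-nonNeg = recip-nonNeg y 0<y

  0<⊓ : ∀ {a b} → 0ℚ ℚ.< a → 0ℚ ℚ.< b → 0ℚ ℚ.< a ℚ.⊓ b
  0<⊓ {a} {b} 0<a 0<b with ℚ.⊓-sel a b
  ... | inj₁ eq = subst (0ℚ ℚ.<_) (sym eq) 0<a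
  ... | inj₂ eq = subst (0ℚ ℚ.<_) (sym eq) 0<b

-- log q  =  ∫₁^q dt/t.  On the interval between 1 and q, 1/t is Lipschitz with
-- constant 1/c², where c is the lower end point.
log : (q : ℚ) .{{_ : Positive q}} → ℝ
log q = integral recip 1ℚ q (recip c ℚ.* recip c)
          (ℚ.nonNegative⁻¹ _ {{ℚ.nonNeg*nonNeg⇒nonNeg (recip c) {{nn}} (recip c) {{nn}}}})
          (recip-lipschitz 1ℚ q 0<c)
  where
  c = 1ℚ ℚ.⊓ q
  0<c : 0ℚ ℚ.< c
  0<c = 0<⊓ (ι-mono-< {0} {1} z<s) (ℚ.positive⁻¹ q)
  nn : ℚ.NonNegative (recip c)
  nn = recip-nonNeg c 0<c

Sequence : Set
Sequence = (n : ℕ) .{{_ : NonZero n}} → ℝ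

infix 4 _=O_

-- The bounding sequence g is used without absolute value, so it is meant to be
-- nonnegative.
_=O_ : Sequence → Sequence → Set
f =O g = ∃[ M ] ∃[ a ] ∀ n .{{_ : NonZero n}} → a ℕ.≤ n → ∣ f n ∣ ≤ M * g n

Limit : Sequence → ℝ → Set
Limit x L = ∀ ε → 0ℝ < ε → ∃[ N ] ∀ n .{{_ : NonZero n}} → N ℕ.≤ n → ∣ x n - L ∣ < ε

Odd : ℤ → Set
Odd z = ¬ (+ 2 ℤ.∣ z)

odd? : ∀ z → Dec (Odd z)
odd? z = ¬? (2 ℕ.∣? ℤ.∣ z ∣)

-- The entry i of upTo n stands for k = i + 1.
𝒞 : ℕ → ℕ
𝒞 n = length (filter (λ i → odd? (ceiling (+ n ℚ./ suc i))) (upTo n))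

{-# OPTIONS --safe #-}

-- Write n = N + 1.  Since ⌈n/k⌉ = ⌊N/k⌋ + 1, 𝒞 n is n minus the number D of
-- k ≤ n for which ⌊N/k⌋ is odd, and D = ⌊N/1⌋ − ⌊N/2⌋ + ⌊N/3⌋ − ⋯.  Stopping after
-- 2m terms leaves a remainder between 0 and ⌊N/(2m+1)⌋, and removing the floors
-- costs at most 1 per pair of terms, so D = n (1 − 1/2 + ⋯ − 1/(2m)) + O(m + n/m).
-- By Catalan's identity 1 − 1/2 + ⋯ − 1/(2m) = 1/(m+1) + ⋯ + 1/(2m), which is the
-- right-endpoint Riemann sum of log 2 with m steps; the alternating sums are
-- within 1/(2m+1) of each later one.  Take m = ⌊√n⌋.

module Submission where

open import Defs
open import Algebra.Properties.CommutativeSemigroup using (interchange)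
open import Algebra.Properties.Group using (∙-cancelʳ)
open import Data.Integer.Base using (+_)
open import Data.Integer.Base as ℤ using (-[1+_])
import Data.Integer.DivMod as ℤ
import Data.Integer.Properties as ℤ
open import Data.List.Base using (applyUpTo; filter; length)
open import Data.Nat.Base as ℕ using (ℕ; zero; suc; z≤n; s≤s; z<s; NonZero)
import Data.Nat.DivMod as ℕ
import Data.Nat.Divisibility as ℕ
open import Data.Nat.ListAction using (sum)
import Data.Nat.Properties as ℕ
import Data.Nat.Tactic.RingSolver as ℕ
open import Data.Product.Base using (_×_)
open import Data.Product.Base using (_,_; proj₁; proj₂; ∃-syntax)
open import Data.Rational.Base using (_/_)
open import Data.Rational.Base as ℚ using (ℚ; mkℚ; 0ℚ; 1ℚ; ½; ceiling)
import Data.Rational.Properties as ℚ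
open import Data.Rational.Solver using (module +-*-Solver)
import Data.Rational.Unnormalised.Base as ℚᵘ
open import Data.Sum.Base using (inj₁; inj₂)
open import Function.Base using (_∘_; id)
open import Relation.Binary.PropositionalEquality
open import Relation.Nullary using (¬_; yes; no; contradiction)
open import Relation.Nullary.Decidable using (decidable-stable)
open import Relation.Unary using (Decidable)
open +-*-Solver using (solve; _:=_; _:+_; _:*_; _:-_; :-_; con)

-- Odd ceilings and quotients

div-spec : ∀ N i → N ℕ.< suc (N ℕ./ suc i) ℕ.* suc i
div-spec N i = begin-strict
  N                                            ≡⟨ ℕ.m≡m%n+[m/n]*n N (suc i) ⟩
  N ℕ.% suc i ℕ.+ (N ℕ./ suc i) ℕ.* suc i      <⟨ ℕ.+-monoˡ-< _ (ℕ.m%n<n N (suc i)) ⟩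
  suc (N ℕ./ suc i) ℕ.* suc i                  ∎
  where open ℕ.≤-Reasoning

-- `ℚ.floor p` meets the same two bounds as `z`, and `below` compares two such integers in either
-- order: if y times the denominator is at most `a`, and `a` is less than z + 1 times it, then y < z
-- + 1.
floor-unique : ∀ p z → z ℤ.* ℚ.↧ p ℤ.≤ ℚ.↥ p → ℚ.↥ p ℤ.< ℤ.suc z ℤ.* ℚ.↧ p → ℚ.floor p ≡ z
floor-unique p@(mkℚ a d _) z lo hi = ℤ.≤-antisym (below hi (ℤ.[n/d]*d≤n a (+ suc d)))
  (below (subst (λ f → a ℤ.< ℤ.suc f ℤ.* + suc d) (sym (ℤ.div-pos-is-/ℕ a (suc d))) (ℤ.n<s[n/ℕd]*d a (suc d))) lo)
  where
  below : ∀ {y z} → a ℤ.< ℤ.suc z ℤ.* + suc d → y ℤ.* + suc d ℤ.≤ a → y ℤ.≤ z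
  below {y} {z} hi lo = subst (y ℤ.≤_) (ℤ.pred-suc z)
    (ℤ.i<j⇒i≤pred[j] {y} {ℤ.suc z} (ℤ.*-cancelʳ-<-nonNeg {y} {ℤ.suc z} (+ suc d) (ℤ.≤-<-trans lo hi)))

-- A ceiling is the negated floor of the negated number, so -(q + 1) has to be the floor of -p. As
-- `p` is stored in lowest terms, the bounds on `n` are carried to its numerator through the cross
-- product a (i + 1) = n (d + 1).
ceiling-unique : ∀ p n q i → ℚ.toℚᵘ p ℚᵘ.≃ ℚᵘ.mkℚᵘ (+ n) i → q ℕ.* suc i ℕ.< n → n ℕ.≤ suc q ℕ.* suc i →
                 ceiling p ≡ + suc q
ceiling-unique p@(mkℚ a d _) n q i (ℚᵘ.*≡* cross) lo hi = cong (λ z → ℤ.- z) (floor-unique (ℚ.- p) -[1+ q ]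
  (ℤ.*-cancelʳ-≤-pos _ _ k (subst₂ ℤ._≤_ (swap -[1+ q ]) negated
    (ℤ.*-monoʳ-≤-nonNeg (+ suc d) (subst (ℤ._≤ ℤ.- + n) neg-* (ℤ.neg-mono-≤ (ℤ.+≤+ hi))))))
  (ℤ.*-cancelʳ-<-nonNeg k (subst₂ ℤ._<_ negated (swap (ℤ.suc -[1+ q ]))
    (ℤ.*-monoʳ-<-pos (+ suc d) (subst (ℤ.- + n ℤ.<_) suc-neg-* (ℤ.neg-mono-< (ℤ.+<+ lo)))))))
  where
  k = + suc i
  open ≡-Reasoning
  negated : ℤ.- + n ℤ.* + suc d ≡ ℚ.↥ (ℚ.- p) ℤ.* k
  negated = begin
    ℤ.- + n ℤ.* + suc d       ≡⟨ ℤ.neg-distribˡ-* (+ n) (+ suc d) ⟨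
    ℤ.- (+ n ℤ.* + suc d)     ≡⟨ cong (λ z → ℤ.- z) cross ⟨
    ℤ.- (a ℤ.* k)             ≡⟨ ℤ.neg-distribˡ-* a k ⟩
    ℤ.- a ℤ.* k               ≡⟨ cong (ℤ._* k) (ℚ.↥-neg p) ⟨
    ℚ.↥ (ℚ.- p) ℤ.* k         ∎
  swap : ∀ z → z ℤ.* k ℤ.* + suc d ≡ z ℤ.* ℚ.↧ (ℚ.- p) ℤ.* k
  swap z = begin
    z ℤ.* k ℤ.* + suc d             ≡⟨ ℤ.*-assoc z k (+ suc d) ⟩
    z ℤ.* (k ℤ.* + suc d)           ≡⟨ cong (z ℤ.*_) (ℤ.*-comm k (+ suc d)) ⟩
    z ℤ.* (+ suc d ℤ.* k)           ≡⟨ ℤ.*-assoc z (+ suc d) k ⟨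
    z ℤ.* + suc d ℤ.* k             ≡⟨ cong (λ e → z ℤ.* e ℤ.* k) (ℚ.↧-neg p) ⟨
    z ℤ.* ℚ.↧ (ℚ.- p) ℤ.* k         ∎
  neg-* : ℤ.- + (suc q ℕ.* suc i) ≡ -[1+ q ] ℤ.* k
  neg-* = trans (cong (λ z → ℤ.- z) (ℤ.pos-* (suc q) (suc i))) (ℤ.neg-distribˡ-* (+ suc q) k)
  suc-neg : ∀ m → ℤ.- + m ≡ ℤ.suc -[1+ m ]
  suc-neg zero    = refl
  suc-neg (suc m) = refl
  suc-neg-* : ℤ.- + (q ℕ.* suc i) ≡ ℤ.suc -[1+ q ] ℤ.* k
  suc-neg-* = trans (cong (λ z → ℤ.- z) (ℤ.pos-* q (suc i)))
    (trans (ℤ.neg-distribˡ-* (+ q) k) (cong (ℤ._* k) (suc-neg q)))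

-- With k = i + 1, floor division gives q k ≤ N < (q + 1) k; in terms of N + 1 this reads q k < N +
-- 1 ≤ (q + 1) k, the bounds of a ceiling.
ceiling-/ : ∀ N i → ceiling (+ suc N ℚ./ suc i) ≡ + suc (N ℕ./ suc i)
ceiling-/ N i = ceiling-unique p (suc N) (N ℕ./ suc i) i
  (ℚ.toℚᵘ-fromℚᵘ (ℚᵘ.mkℚᵘ (+ suc N) i)) (s≤s (ℕ.m/n*n≤m N (suc i))) (div-spec N i)
  where p = + suc N ℚ./ suc i

-- Here `f` is the indicator of the complement of `P`. The enumeration `g` is left free because the
-- induction passes from `g` to `g ∘ suc`; `upTo` is the case `id`.
length-filter+sum : ∀ {P : ℕ → Set} (P? : Decidable P) f → (∀ i → P i → f i ≡ 0) → (∀ i → ¬ P i → f i ≡ 1) →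
          ∀ (g : ℕ → ℕ) n → length (filter P? (applyUpTo g n)) ℕ.+ sum (applyUpTo (f ∘ g) n) ≡ n
length-filter+sum P? f yes⇒0 no⇒1 g zero = refl
length-filter+sum P? f yes⇒0 no⇒1 g (suc n) with P? (g 0) | length-filter+sum P? f yes⇒0 no⇒1 (g ∘ suc) n
... | yes p | ih rewrite yes⇒0 _ p = cong suc ih
... | no ¬p | ih rewrite no⇒1 _ ¬p = trans (ℕ.+-suc _ _) (cong suc ih)

¬2∣suc⇒%2≡0 : ∀ u → ¬ (2 ℕ.∣ suc u) → u ℕ.% 2 ≡ 0
¬2∣suc⇒%2≡0 zero          odd = refl
¬2∣suc⇒%2≡0 (suc zero)    odd = contradiction (ℕ.∣-refl {2}) odd
¬2∣suc⇒%2≡0 (suc (suc u)) odd = ¬2∣suc⇒%2≡0 u (λ 2∣ → odd (ℕ.∣m∣n⇒∣m+n (ℕ.∣-refl {2}) 2∣))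

2∣suc⇒%2≡1 : ∀ u → 2 ℕ.∣ suc u → u ℕ.% 2 ≡ 1
2∣suc⇒%2≡1 zero          2∣1 = contradiction (ℕ.∣1⇒≡1 2∣1) λ ()
2∣suc⇒%2≡1 (suc zero)    2∣2 = refl
2∣suc⇒%2≡1 (suc (suc u)) 2∣ = 2∣suc⇒%2≡1 u (ℕ.∣m+n∣m⇒∣n {2} {2} {suc u} 2∣ ℕ.∣-refl)

-- The number of k ≤ N + 1 for which ⌊N/k⌋ is odd and exceeds 2m.
oddQuotients : ℕ → ℕ → ℕ
oddQuotients N m = sum (applyUpTo (λ i → (N ℕ./ suc i ℕ.∸ m ℕ.* 2) ℕ.% 2) (suc N))

-- Adding 1 flips parity, so a ceiling is odd exactly when its quotient is even, and the two counts
-- run over complementary sets of k.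
𝒞+oddQuotients : ∀ N → 𝒞 (suc N) ℕ.+ oddQuotients N 0 ≡ suc N
𝒞+oddQuotients N = length-filter+sum (λ i → odd? (ceiling (+ suc N ℚ./ suc i))) (λ i → (N ℕ./ suc i) ℕ.% 2)
  (λ i odd → ¬2∣suc⇒%2≡0 _ (subst Odd (ceiling-/ N i) odd))
  -- Failing to be `Odd` is a double negation of divisibility by 2, which decidability removes.
  (λ i even → 2∣suc⇒%2≡1 _ (decidable-stable (2 ℕ.∣? _) (subst (¬_ ∘ Odd) (ceiling-/ N i) even)))
  id (suc N)

-- Sums of natural numbers and the double count of quotients

sum-cong : ∀ {f g : ℕ → ℕ} n → (∀ i → f i ≡ g i) → sum (applyUpTo f n) ≡ sum (applyUpTo g n)
sum-cong zero    eq = refl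
sum-cong (suc n) eq = cong₂ ℕ._+_ (eq 0) (sum-cong n (eq ∘ suc))

sum-mono : ∀ {f g : ℕ → ℕ} n → (∀ i → f i ℕ.≤ g i) → sum (applyUpTo f n) ℕ.≤ sum (applyUpTo g n)
sum-mono zero    le = z≤n
sum-mono (suc n) le = ℕ.+-mono-≤ (le 0) (sum-mono n (le ∘ suc))

sum-+ : ∀ (f g : ℕ → ℕ) n →
        sum (applyUpTo (λ i → f i ℕ.+ g i) n) ≡ sum (applyUpTo f n) ℕ.+ sum (applyUpTo g n)
sum-+ f g zero    = refl
sum-+ f g (suc n) = trans (cong (f 0 ℕ.+ g 0 ℕ.+_) (sum-+ (f ∘ suc) (g ∘ suc) n)) (interchange ℕ.+-commutativeSemigroup (f 0) (g 0) _ _)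

sum-0 : ∀ n → sum (applyUpTo (λ _ → 0) n) ≡ 0
sum-0 zero    = refl
sum-0 (suc n) = sum-0 n

-- 1 ⊓ (q ∸ i) is the indicator of i < q.
sum-1⊓ : ∀ q n → sum (applyUpTo (λ i → 1 ℕ.⊓ (q ℕ.∸ i)) n) ≡ n ℕ.⊓ q
sum-1⊓ q       zero    = refl
sum-1⊓ zero    (suc n) = trans (sum-cong n (λ i → refl)) (sum-0 n)
sum-1⊓ (suc q) (suc n) = cong suc (sum-1⊓ q n)

1⊓-cong : ∀ {a b} → (a ≡ 0 → b ≡ 0) → (b ≡ 0 → a ≡ 0) → 1 ℕ.⊓ a ≡ 1 ℕ.⊓ b
1⊓-cong {zero}  {zero}  f g = refl
1⊓-cong {zero}  {suc b} f g = contradiction (f refl) λ ()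
1⊓-cong {suc a} {zero}  f g = contradiction (g refl) λ ()
1⊓-cong {suc a} {suc b} f g = refl

-- Both sides indicate that (i + 1) (j + 1) ≤ N.
1⊓-/-comm : ∀ N i j → 1 ℕ.⊓ (N ℕ./ suc i ℕ.∸ j) ≡ 1 ℕ.⊓ (N ℕ./ suc j ℕ.∸ i)
1⊓-/-comm N i j = 1⊓-cong (swap i j) (swap j i)
  where
  swap : ∀ i j → N ℕ./ suc i ℕ.∸ j ≡ 0 → N ℕ./ suc j ℕ.∸ i ≡ 0
  swap i j eq = ℕ.m≤n⇒m∸n≡0 (ℕ.s≤s⁻¹ (ℕ.m<n*o⇒m/o<n {N} {suc i} {suc j} (begin-strict
    N                                  <⟨ div-spec N i ⟩
    suc (N ℕ./ suc i) ℕ.* suc i        ≤⟨ ℕ.*-monoˡ-≤ (suc i) (s≤s (ℕ.m∸n≡0⇒m≤n {N ℕ./ suc i} {j} eq)) ⟩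
    suc j ℕ.* suc i                    ≡⟨ ℕ.*-comm (suc j) (suc i) ⟩
    suc i ℕ.* suc j                    ∎)))
    where open ℕ.≤-Reasoning

-- By symmetry the summand becomes the indicator of i < ⌊N/(j + 1)⌋, and N + 1 terms are enough to
-- reach that quotient.
sum-1⊓-/ : ∀ N j → sum (applyUpTo (λ i → 1 ℕ.⊓ (N ℕ./ suc i ℕ.∸ j)) (suc N)) ≡ N ℕ./ suc j
sum-1⊓-/ N j = begin
  sum (applyUpTo (λ i → 1 ℕ.⊓ (N ℕ./ suc i ℕ.∸ j)) (suc N))   ≡⟨ sum-cong (suc N) (λ i → 1⊓-/-comm N i j) ⟩
  sum (applyUpTo (λ i → 1 ℕ.⊓ (N ℕ./ suc j ℕ.∸ i)) (suc N))   ≡⟨ sum-1⊓ (N ℕ./ suc j) (suc N) ⟩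
  suc N ℕ.⊓ (N ℕ./ suc j)                                     ≡⟨ ℕ.m≥n⇒m⊓n≡n (ℕ.m≤n⇒m≤1+n (ℕ.m/n≤m N (suc j))) ⟩
  N ℕ./ suc j                                                 ∎
  where open ≡-Reasoning

-- Put x = u ∸ a. If x ≥ 2, both indicators are 1 and parity has period 2; if x ≤ 1, the parity of x
-- is the indicator of x > 0. Iterated, this writes parity as an alternating sum of indicators.
%2-step : ∀ u a → (u ℕ.∸ a) ℕ.% 2 ℕ.+ 1 ℕ.⊓ (u ℕ.∸ suc a) ≡ 1 ℕ.⊓ (u ℕ.∸ a) ℕ.+ (u ℕ.∸ suc (suc a)) ℕ.% 2
%2-step zero          zero    = refl
%2-step (suc zero)    zero    = refl
%2-step (suc (suc u)) zero    = ℕ.+-comm (u ℕ.% 2) 1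
%2-step zero          (suc a) = refl
%2-step (suc u)       (suc a) = %2-step u a

%2≤1⊓ : ∀ u → u ℕ.% 2 ℕ.≤ 1 ℕ.⊓ u
%2≤1⊓ zero    = z≤n
%2≤1⊓ (suc u) = ℕ.s≤s⁻¹ (ℕ.m%n<n (suc u) 2)

-- Summing `%2-step` over all i turns its two indicators into consecutive quotients and so splits
-- off one pair of the alternating series. The form with sums on both sides avoids truncated
-- subtraction.
oddQuotients-step : ∀ N m →
  oddQuotients N m ℕ.+ N ℕ./ suc (suc (m ℕ.* 2)) ≡ N ℕ./ suc (m ℕ.* 2) ℕ.+ oddQuotients N (suc m)
oddQuotients-step N m = begin
  oddQuotients N m ℕ.+ N ℕ./ suc (suc a)                                        ≡⟨ cong (oddQuotients N m ℕ.+_) (sum-1⊓-/ N (suc a)) ⟨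
  oddQuotients N m ℕ.+ sum (applyUpTo (above (suc a)) (suc N))                  ≡⟨ sum-+ (rest m) (above (suc a)) (suc N) ⟨
  sum (applyUpTo (λ i → rest m i ℕ.+ above (suc a) i) (suc N))                  ≡⟨ sum-cong (suc N) (λ i → %2-step (N ℕ./ suc i) a) ⟩
  sum (applyUpTo (λ i → above a i ℕ.+ rest (suc m) i) (suc N))                  ≡⟨ sum-+ (above a) (rest (suc m)) (suc N) ⟩
  sum (applyUpTo (above a) (suc N)) ℕ.+ oddQuotients N (suc m)                  ≡⟨ cong (ℕ._+ oddQuotients N (suc m)) (sum-1⊓-/ N a) ⟩
  N ℕ./ suc a ℕ.+ oddQuotients N (suc m)                                        ∎
  where
  open ≡-Reasoning
  a = m ℕ.* 2
  above rest : ℕ → ℕ → ℕ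
  above j i = 1 ℕ.⊓ (N ℕ./ suc i ℕ.∸ j)
  rest m i = (N ℕ./ suc i ℕ.∸ m ℕ.* 2) ℕ.% 2

-- A parity is at most the indicator of being positive, so the remainder is bounded by the first
-- omitted term.
oddQuotients≤ : ∀ N m → oddQuotients N m ℕ.≤ N ℕ./ suc (m ℕ.* 2)
oddQuotients≤ N m = subst (oddQuotients N m ℕ.≤_) (sum-1⊓-/ N (m ℕ.* 2))
  (sum-mono (suc N) (λ i → %2≤1⊓ (N ℕ./ suc i ℕ.∸ m ℕ.* 2)))

-- The alternating harmonic sums

∣p∣≤q : ∀ {p q} → p ℚ.≤ q → ℚ.- p ℚ.≤ q → ℚ.∣ p ∣ ℚ.≤ q
∣p∣≤q {p} {q} p≤q -p≤q with ℚ.∣p∣≡p∨∣p∣≡-p p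
... | inj₁ eq = subst (ℚ._≤ q) (sym eq) p≤q
... | inj₂ eq = subst (ℚ._≤ q) (sym eq) -p≤q

p≤p+q : ∀ p {q} → 0ℚ ℚ.≤ q → p ℚ.≤ p ℚ.+ q
p≤p+q p {q} 0≤q = subst (ℚ._≤ p ℚ.+ q) (ℚ.+-identityʳ p) (ℚ.+-monoʳ-≤ p 0≤q)

∣p-q∣≤r : ∀ p q r → p ℚ.≤ q ℚ.+ r → q ℚ.≤ p ℚ.+ r → ℚ.∣ p ℚ.- q ∣ ℚ.≤ r
∣p-q∣≤r p q r p≤ q≤ = ∣p∣≤q
  (subst (p ℚ.- q ℚ.≤_) (solve 2 (λ q r → q :+ r :- q := r) refl q r) (ℚ.+-monoˡ-≤ (ℚ.- q) p≤))
  (subst₂ ℚ._≤_ (solve 2 (λ p q → q :- p := :- (p :- q)) refl p q)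
    (solve 2 (λ p r → p :+ r :- p := r) refl p r) (ℚ.+-monoˡ-≤ (ℚ.- p) q≤))

1/suc : ℕ → ℚ
1/suc j = + 1 ℚ./ suc j

1/suc-nonNeg : ∀ j → ℚ.NonNegative (1/suc j)
1/suc-nonNeg j = ℚ.normalize-nonNeg 1 (suc j)

0≤1/suc : ∀ j → 0ℚ ℚ.≤ 1/suc j
0≤1/suc j = ℚ.nonNegative⁻¹ (1/suc j) {{1/suc-nonNeg j}}

ι*1/suc : ∀ j → ι (suc j) ℚ.* 1/suc j ≡ 1ℚ
ι*1/suc j = trans (ℚ.*-comm (ι (suc j)) (1/suc j)) (/-ι 1 (suc j))

ι[m*suc]*1/suc : ∀ m j → ι (m ℕ.* suc j) ℚ.* 1/suc j ≡ ι m
ι[m*suc]*1/suc m j = begin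
  ι (m ℕ.* suc j) ℚ.* 1/suc j         ≡⟨ cong (ℚ._* 1/suc j) (ι-* m (suc j)) ⟩
  ι m ℚ.* ι (suc j) ℚ.* 1/suc j       ≡⟨ ℚ.*-assoc (ι m) (ι (suc j)) (1/suc j) ⟩
  ι m ℚ.* (ι (suc j) ℚ.* 1/suc j)     ≡⟨ cong (ι m ℚ.*_) (ι*1/suc j) ⟩
  ι m ℚ.* 1ℚ                          ≡⟨ ℚ.*-identityʳ (ι m) ⟩
  ι m                                 ∎
  where open ≡-Reasoning

*1/suc-mono : ∀ {m n} j → m ℕ.≤ n → ι m ℚ.* 1/suc j ℚ.≤ ι n ℚ.* 1/suc j
*1/suc-mono j m≤n = ℚ.*-monoʳ-≤-nonNeg (1/suc j) {{1/suc-nonNeg j}} (ι-mono-≤ m≤n)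

1/suc-anti : ∀ j → 1/suc (suc j) ℚ.≤ 1/suc j
1/suc-anti j = begin
  1/suc (suc j)                                       ≡⟨ ℚ.*-identityˡ (1/suc (suc j)) ⟨
  1ℚ ℚ.* 1/suc (suc j)                                ≡⟨ cong (ℚ._* 1/suc (suc j)) (/-ι 1 (suc j)) ⟨
  1/suc j ℚ.* ι (suc j) ℚ.* 1/suc (suc j)             ≡⟨ ℚ.*-assoc (1/suc j) (ι (suc j)) (1/suc (suc j)) ⟩
  1/suc j ℚ.* (ι (suc j) ℚ.* 1/suc (suc j))           ≤⟨ ℚ.*-monoˡ-≤-nonNeg (1/suc j) {{1/suc-nonNeg j}}
                                                           (*1/suc-mono (suc j) (ℕ.n≤1+n (suc j))) ⟩
  1/suc j ℚ.* (ι (suc (suc j)) ℚ.* 1/suc (suc j))     ≡⟨ cong (1/suc j ℚ.*_) (ι*1/suc (suc j)) ⟩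
  1/suc j ℚ.* 1ℚ                                      ≡⟨ ℚ.*-identityʳ (1/suc j) ⟩
  1/suc j                                             ∎
  where open ℚ.≤-Reasoning

1/suc-double : ∀ m → 1/suc m ≡ 1/suc (suc (m ℕ.* 2)) ℚ.+ 1/suc (suc (m ℕ.* 2))
1/suc-double m = begin
  u                                            ≡⟨ ℚ.*-identityʳ u ⟨
  u ℚ.* 1ℚ                                     ≡⟨ cong (u ℚ.*_) (ι*1/suc (suc (m ℕ.* 2))) ⟨
  u ℚ.* (ι (suc m ℕ.* 2) ℚ.* v)                ≡⟨ cong (λ z → u ℚ.* (z ℚ.* v)) (ι-* (suc m) 2) ⟩
  u ℚ.* (ι (suc m) ℚ.* (1ℚ ℚ.+ 1ℚ) ℚ.* v)      ≡⟨ solve 3 (λ u n v → u :* (n :* (con 1ℚ :+ con 1ℚ) :* v)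
                                                    := (u :* n) :* (v :+ v)) refl u (ι (suc m)) v ⟩
  u ℚ.* ι (suc m) ℚ.* (v ℚ.+ v)                ≡⟨ cong (ℚ._* (v ℚ.+ v)) (/-ι 1 (suc m)) ⟩
  1ℚ ℚ.* (v ℚ.+ v)                             ≡⟨ ℚ.*-identityˡ (v ℚ.+ v) ⟩
  v ℚ.+ v                                      ∎
  where
  open ≡-Reasoning
  u = 1/suc m
  v = 1/suc (suc (m ℕ.* 2))

-- The terms are taken in pairs, so `alternating m` has 2m terms, ends in -1/(2m) and has only
-- nonnegative summands.
alternating : ℕ → ℚ
alternating = ∑ λ j → 1/suc (j ℕ.* 2) ℚ.- 1/suc (suc (j ℕ.* 2))

-- The harmonic term 1/(m + 1) is 2/(2m + 2), which turns the last term -1/(2m + 2) into +1/(2m +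
-- 2).
alternating+harmonic : ∀ m → alternating m ℚ.+ ∑ 1/suc m ≡ ∑ 1/suc (m ℕ.* 2)
alternating+harmonic zero    = refl
alternating+harmonic (suc m) = begin
  a ℚ.+ (u ℚ.- v) ℚ.+ (h ℚ.+ 1/suc m)     ≡⟨ cong (λ z → a ℚ.+ (u ℚ.- v) ℚ.+ (h ℚ.+ z)) (1/suc-double m) ⟩
  a ℚ.+ (u ℚ.- v) ℚ.+ (h ℚ.+ (v ℚ.+ v))   ≡⟨ solve 4 (λ a u v h → a :+ (u :- v) :+ (h :+ (v :+ v))
                                               := a :+ h :+ u :+ v) refl a u v h ⟩
  a ℚ.+ h ℚ.+ u ℚ.+ v                     ≡⟨ cong (λ z → z ℚ.+ u ℚ.+ v) (alternating+harmonic m) ⟩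
  ∑ 1/suc (suc m ℕ.* 2)                   ∎
  where
  open ≡-Reasoning
  a = alternating m
  h = ∑ 1/suc m
  u = 1/suc (m ℕ.* 2)
  v = 1/suc (suc (m ℕ.* 2))

-- Catalan's identity: cancelling the first m terms of the harmonic sum of length 2m leaves its
-- second half.
alternating≡∑ : ∀ m → alternating m ≡ ∑ (λ i → 1/suc (m ℕ.+ i)) m
alternating≡∑ m = ∙-cancelʳ ℚ.+-0-group (∑ 1/suc m) _ _ (begin
  alternating m ℚ.+ ∑ 1/suc m                          ≡⟨ alternating+harmonic m ⟩
  ∑ 1/suc (m ℕ.* 2)                                    ≡⟨ cong (∑ 1/suc) (*2≡ m) ⟩
  ∑ 1/suc (m ℕ.+ m)                                    ≡⟨ ∑-+ 1/suc m m ⟩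
  ∑ 1/suc m ℚ.+ ∑ (λ i → 1/suc (m ℕ.+ i)) m            ≡⟨ ℚ.+-comm (∑ 1/suc m) _ ⟩
  ∑ (λ i → 1/suc (m ℕ.+ i)) m ℚ.+ ∑ 1/suc m            ∎)
  where
  open ≡-Reasoning
  *2≡ : ∀ m → m ℕ.* 2 ≡ m ℕ.+ m
  *2≡ = ℕ.solve-∀

∑-cong : ∀ {f g : ℕ → ℚ} n → (∀ i → f i ≡ g i) → ∑ f n ≡ ∑ g n
∑-cong zero    eq = refl
∑-cong (suc n) eq = cong₂ ℚ._+_ (∑-cong n eq) (eq n)

-- With M = m + 1 steps, the node is p = 1 + (i + 1)/M = (M + i + 1)/M, so its term, 1/p times 1/M,
-- is 1/(M + i + 1), as in Catalan's identity.
riemannSum-log2 : ∀ m → riemannSum recip 1ℚ (+ 2 / 1) (suc m) ≡ alternating (suc m)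
riemannSum-log2 m = trans (∑-cong (suc m) term) (sym (alternating≡∑ (suc m)))
  where
  open ≡-Reasoning
  u = 1/suc m
  h = step 1ℚ (+ 2 / 1) (suc m)
  h≡u : h ≡ u
  h≡u = ℚ.*-identityˡ u
  term : ∀ i → recip (1ℚ ℚ.+ ι (suc i) ℚ.* h) ℚ.* h ≡ 1/suc (suc m ℕ.+ i)
  term i = begin
    recip (1ℚ ℚ.+ ι (suc i) ℚ.* h) ℚ.* h      ≡⟨ cong (λ z → recip (1ℚ ℚ.+ ι (suc i) ℚ.* z) ℚ.* z) h≡u ⟩
    recip p ℚ.* u                             ≡⟨ cong (recip p ℚ.*_) u≡pw ⟩
    recip p ℚ.* (p ℚ.* w)                     ≡⟨ solve 3 (λ r p w → r :* (p :* w) := (p :* r) :* w) refl (recip p) p w ⟩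
    p ℚ.* recip p ℚ.* w                       ≡⟨ cong (ℚ._* w) (*-recip p 0<p) ⟩
    1ℚ ℚ.* w                                  ≡⟨ ℚ.*-identityˡ w ⟩
    w                                         ∎
    where
    p = 1ℚ ℚ.+ ι (suc i) ℚ.* u
    w = 1/suc (suc m ℕ.+ i)
    0<p : 0ℚ ℚ.< p
    0<p = ℚ.+-mono-<-≤ (ι-mono-< {0} {1} z<s)
      (subst (ℚ._≤ ι (suc i) ℚ.* u) (ℚ.*-zeroˡ u) (*1/suc-mono {0} {suc i} m z≤n))
    u≡pw : u ≡ p ℚ.* w
    u≡pw = sym (begin
      (1ℚ ℚ.+ ι (suc i) ℚ.* u) ℚ.* w                   ≡⟨ cong (λ z → (z ℚ.+ ι (suc i) ℚ.* u) ℚ.* w) (/-ι 1 (suc m)) ⟨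
      (u ℚ.* ι (suc m) ℚ.+ ι (suc i) ℚ.* u) ℚ.* w      ≡⟨ solve 4 (λ u a b w → (u :* a :+ b :* u) :* w := u :* ((a :+ b) :* w))
                                                            refl u (ι (suc m)) (ι (suc i)) w ⟩
      u ℚ.* ((ι (suc m) ℚ.+ ι (suc i)) ℚ.* w)          ≡⟨ cong (λ z → u ℚ.* (z ℚ.* w)) (ι-+ (suc m) (suc i)) ⟨
      u ℚ.* (ι (suc m ℕ.+ suc i) ℚ.* w)                ≡⟨ cong (λ k → u ℚ.* (ι k ℚ.* w)) (ℕ.+-suc (suc m) i) ⟩
      u ℚ.* (ι (suc (suc m ℕ.+ i)) ℚ.* w)              ≡⟨ cong (u ℚ.*_) (ι*1/suc (suc m ℕ.+ i)) ⟩
      u ℚ.* 1ℚ                                         ≡⟨ ℚ.*-identityʳ u ⟩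
      u                                                ∎)

alternating-increasing : ∀ k m → alternating m ℚ.≤ alternating (k ℕ.+ m)
alternating-increasing zero    m = ℚ.≤-refl
alternating-increasing (suc k) m = ℚ.≤-trans (alternating-increasing k m) (p≤p+q (alternating (k ℕ.+ m))
  (subst (ℚ._≤ 1/suc a ℚ.- 1/suc (suc a)) (ℚ.+-inverseʳ (1/suc (suc a)))
    (ℚ.+-monoˡ-≤ (ℚ.- 1/suc (suc a)) (1/suc-anti a))))
  where a = (k ℕ.+ m) ℕ.* 2

-- These are the partial sums with an odd number of terms; each step adds -1/(2j + 2) + 1/(2j + 3),
-- which is not positive.
alternating-decreasing : ∀ k m → alternating (k ℕ.+ m) ℚ.+ 1/suc ((k ℕ.+ m) ℕ.* 2) ℚ.≤ alternating m ℚ.+ 1/suc (m ℕ.* 2)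
alternating-decreasing zero    m = ℚ.≤-refl
alternating-decreasing (suc k) m = ℚ.≤-trans (begin
  alternating j ℚ.+ (1/suc a ℚ.- 1/suc (suc a)) ℚ.+ 1/suc (suc (suc a))
    ≤⟨ ℚ.+-monoʳ-≤ (alternating j ℚ.+ (1/suc a ℚ.- 1/suc (suc a))) (1/suc-anti (suc a)) ⟩
  alternating j ℚ.+ (1/suc a ℚ.- 1/suc (suc a)) ℚ.+ 1/suc (suc a)
    ≡⟨ solve 3 (λ x u v → x :+ (u :- v) :+ v := x :+ u) refl (alternating j) (1/suc a) (1/suc (suc a)) ⟩
  alternating j ℚ.+ 1/suc a
    ∎) (alternating-decreasing k m)
  where
  open ℚ.≤-Reasoning
  j = k ℕ.+ m
  a = j ℕ.* 2

-- The Leibniz bound: every later even partial sum lies between the even sum at `m` and the odd sum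
-- that follows it.
alternating-close : ∀ {m j} → m ℕ.≤ j → ℚ.∣ alternating j ℚ.- alternating m ∣ ℚ.≤ 1/suc (m ℕ.* 2)
alternating-close {m} {j} m≤j = subst (λ j → ℚ.∣ alternating j ℚ.- alternating m ∣ ℚ.≤ 1/suc (m ℕ.* 2)) (ℕ.m∸n+n≡m m≤j)
  (∣p-q∣≤r (alternating (k ℕ.+ m)) (alternating m) (1/suc (m ℕ.* 2))
    (ℚ.≤-trans (p≤p+q _ (0≤1/suc ((k ℕ.+ m) ℕ.* 2))) (alternating-decreasing k m))
    (ℚ.≤-trans (alternating-increasing k m) (p≤p+q _ (0≤1/suc (m ℕ.* 2)))))
  where k = j ℕ.∸ m

-- From floors to the estimate of `𝒞` with a free cutoff

/-upper : ∀ N j → ι (N ℕ./ suc j) ℚ.≤ ι (suc N) ℚ.* 1/suc j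
/-upper N j = subst (ℚ._≤ ι (suc N) ℚ.* 1/suc j) (ι[m*suc]*1/suc (N ℕ./ suc j) j)
  (*1/suc-mono j (ℕ.m≤n⇒m≤1+n (ℕ.m/n*n≤m N (suc j))))

-- Replacing N by N + 1 still leaves an error of at most 1, since N < (q + 1)(j + 1) already means N
-- + 1 ≤ (q + 1)(j + 1).
/-lower : ∀ N j → ι (suc N) ℚ.* 1/suc j ℚ.≤ ι (N ℕ./ suc j) ℚ.+ 1ℚ
/-lower N j = subst (ι (suc N) ℚ.* 1/suc j ℚ.≤_)
  (trans (ι[m*suc]*1/suc (suc (N ℕ./ suc j)) j) (trans (ι-+ 1 (N ℕ./ suc j)) (ℚ.+-comm 1ℚ (ι (N ℕ./ suc j)))))
  (*1/suc-mono j (div-spec N j))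

-- Each quotient exceeds its floor by between 0 and 1. The two excesses in a pair enter with
-- opposite signs, so a pair contributes an error of at most 1.
oddQuotients-estimate : ∀ N m →
  ℚ.∣ ι (oddQuotients N 0) ℚ.- ι (oddQuotients N m) ℚ.- ι (suc N) ℚ.* alternating m ∣ ℚ.≤ ι m
oddQuotients-estimate N zero = ℚ.≤-reflexive (cong ℚ.∣_∣
  (solve 2 (λ s n → s :- s :- n :* con 0ℚ := con 0ℚ) refl (ι (oddQuotients N 0)) (ι (suc N))))
oddQuotients-estimate N (suc m) = begin
  ℚ.∣ s₀ ℚ.- s′ ℚ.- n ℚ.* (alternating m ℚ.+ (g ℚ.- g′)) ∣
    ≡⟨ cong ℚ.∣_∣ (trans
        -- The value `f′` is added and subtracted so that `s-step` can rewrite `s + f′`.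
        (solve 8 (λ s₀ s s′ n x g g′ f → s₀ :- s′ :- n :* (x :+ (g :- g′)) :=
          (s₀ :- s :- n :* x) :+ (((s :+ f) :- s′ :- f) :- (n :* g :- n :* g′))) refl
          s₀ s s′ n (alternating m) g g′ f′)
        (cong (λ z → (s₀ ℚ.- s ℚ.- n ℚ.* alternating m) ℚ.+ ((z ℚ.- s′ ℚ.- f′) ℚ.- (n ℚ.* g ℚ.- n ℚ.* g′))) s-step)) ⟩
  ℚ.∣ e ℚ.+ ((f ℚ.+ s′ ℚ.- s′ ℚ.- f′) ℚ.- (n ℚ.* g ℚ.- n ℚ.* g′)) ∣
    ≤⟨ ℚ.∣p+q∣≤∣p∣+∣q∣ e _ ⟩
  ℚ.∣ e ∣ ℚ.+ ℚ.∣ (f ℚ.+ s′ ℚ.- s′ ℚ.- f′) ℚ.- (n ℚ.* g ℚ.- n ℚ.* g′) ∣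
    -- Regrouped so that each side pairs one floor with the other quotient; the bounds `/-upper` and
    -- `/-lower` then apply once each in both directions.
    ≡⟨ cong (λ z → ℚ.∣ e ∣ ℚ.+ ℚ.∣ z ∣) (solve 5 (λ f f′ s′ x y → (f :+ s′ :- s′ :- f′) :- (x :- y)
         := (f :+ y) :- (x :+ f′)) refl f f′ s′ (n ℚ.* g) (n ℚ.* g′)) ⟩
  ℚ.∣ e ∣ ℚ.+ ℚ.∣ (f ℚ.+ n ℚ.* g′) ℚ.- (n ℚ.* g ℚ.+ f′) ∣
    ≤⟨ ℚ.+-mono-≤ (oddQuotients-estimate N m) (∣p-q∣≤r _ _ 1ℚ
         (subst (f ℚ.+ n ℚ.* g′ ℚ.≤_) (sym (ℚ.+-assoc (n ℚ.* g) f′ 1ℚ))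
           (ℚ.+-mono-≤ (/-upper N a) (/-lower N (suc a))))
         (subst (n ℚ.* g ℚ.+ f′ ℚ.≤_) (solve 3 (λ f o x → (f :+ o) :+ x := f :+ x :+ o) refl f 1ℚ (n ℚ.* g′))
           (ℚ.+-mono-≤ (/-lower N a) (/-upper N (suc a))))) ⟩
  ι m ℚ.+ 1ℚ
    ≡⟨ trans (ℚ.+-comm (ι m) 1ℚ) (sym (ι-+ 1 m)) ⟩
  ι (suc m)
    ∎
  where
  open ℚ.≤-Reasoning
  a = m ℕ.* 2
  n = ι (suc N)
  s₀ = ι (oddQuotients N 0)
  s = ι (oddQuotients N m)
  s′ = ι (oddQuotients N (suc m))
  f = ι (N ℕ./ suc a)
  f′ = ι (N ℕ./ suc (suc a))
  g = 1/suc a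
  g′ = 1/suc (suc a)
  e = s₀ ℚ.- s ℚ.- n ℚ.* alternating m
  s-step : s ℚ.+ f′ ≡ f ℚ.+ s′
  s-step = trans (sym (ι-+ (oddQuotients N m) (N ℕ./ suc (suc a)))) (trans
    (cong ι (oddQuotients-step N m)) (ι-+ (N ℕ./ suc a) (oddQuotients N (suc m))))

-- The error splits as n (r - x) - e - s: from the cutoff `m` to the Riemann sum, from the floors,
-- and from the remainder. These parts are at most n/(2m + 1), m and n/(2m + 1). The condition m ≤ t
-- + 1 makes `r` a later partial sum than `x`.
𝒞-estimate : ∀ N m t → m ℕ.≤ suc t → suc N ℕ.≤ m ℕ.* m ℕ.+ 2 ℕ.* m →
  ℚ.∣ ι (𝒞 (suc N)) ℚ.- (1ℚ ℚ.- riemannSum recip 1ℚ (+ 2 / 1) (suc t)) ℚ.* ι (suc N) ∣ ℚ.≤ ι (m ℕ.+ (m ℕ.+ 2))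
𝒞-estimate N m t m≤t N≤ = begin
  ℚ.∣ c ℚ.- (1ℚ ℚ.- riemannSum recip 1ℚ (+ 2 / 1) (suc t)) ℚ.* n ∣
    ≡⟨ cong (λ r → ℚ.∣ c ℚ.- (1ℚ ℚ.- r) ℚ.* n ∣) (riemannSum-log2 t) ⟩
  ℚ.∣ c ℚ.- (1ℚ ℚ.- r) ℚ.* n ∣
    ≡⟨ cong ℚ.∣_∣ (trans
         (solve 6 (λ c s₀ s n r x → c :- (con 1ℚ :- r) :* n :=
           ((c :+ s₀) :- n) :+ (n :* (r :- x) :- (s₀ :- s :- n :* x) :- s)) refl c s₀ s n r x)
         (trans (cong (λ z → (z ℚ.- n) ℚ.+ d) (trans (sym (ι-+ (𝒞 (suc N)) (oddQuotients N 0))) (cong ι (𝒞+oddQuotients N))))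
           (solve 2 (λ n d → (n :- n) :+ d := d) refl n d))) ⟩
  ℚ.∣ n ℚ.* (r ℚ.- x) ℚ.- e ℚ.- s ∣
    ≤⟨ ℚ.≤-trans (∣p-q∣≤∣p∣+∣q∣ (n ℚ.* (r ℚ.- x) ℚ.- e) s) (ℚ.+-monoˡ-≤ ℚ.∣ s ∣ (∣p-q∣≤∣p∣+∣q∣ (n ℚ.* (r ℚ.- x)) e)) ⟩
  ℚ.∣ n ℚ.* (r ℚ.- x) ∣ ℚ.+ ℚ.∣ e ∣ ℚ.+ ℚ.∣ s ∣
    ≤⟨ ℚ.+-mono-≤ (ℚ.+-mono-≤ tail (oddQuotients-estimate N m)) last ⟩
  n ℚ.* g ℚ.+ ι m ℚ.+ n ℚ.* g
    ≡⟨ solve 3 (λ n g m → n :* g :+ m :+ n :* g := m :+ (n :+ n) :* g) refl n g (ι m) ⟩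
  ι m ℚ.+ (n ℚ.+ n) ℚ.* g
    ≡⟨ cong (λ z → ι m ℚ.+ z ℚ.* g) (ι-+ (suc N) (suc N)) ⟨
  ι m ℚ.+ ι (suc N ℕ.+ suc N) ℚ.* g
    ≤⟨ ℚ.+-monoʳ-≤ (ι m) (*1/suc-mono (m ℕ.* 2) double) ⟩
  ι m ℚ.+ ι ((m ℕ.+ 2) ℕ.* suc (m ℕ.* 2)) ℚ.* g
    ≡⟨ cong (ι m ℚ.+_) (ι[m*suc]*1/suc (m ℕ.+ 2) (m ℕ.* 2)) ⟩
  ι m ℚ.+ ι (m ℕ.+ 2)
    ≡⟨ ι-+ m (m ℕ.+ 2) ⟨
  ι (m ℕ.+ (m ℕ.+ 2)) ∎
  where
  open ℚ.≤-Reasoning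
  c = ι (𝒞 (suc N))
  n = ι (suc N)
  s₀ = ι (oddQuotients N 0)
  s = ι (oddQuotients N m)
  r = alternating (suc t)
  x = alternating m
  g = 1/suc (m ℕ.* 2)
  e = s₀ ℚ.- s ℚ.- n ℚ.* x
  d = n ℚ.* (r ℚ.- x) ℚ.- e ℚ.- s
  ∣p-q∣≤∣p∣+∣q∣ : ∀ p q → ℚ.∣ p ℚ.- q ∣ ℚ.≤ ℚ.∣ p ∣ ℚ.+ ℚ.∣ q ∣
  ∣p-q∣≤∣p∣+∣q∣ p q = subst (λ z → ℚ.∣ p ℚ.- q ∣ ℚ.≤ ℚ.∣ p ∣ ℚ.+ z) (ℚ.∣-p∣≡∣p∣ q) (ℚ.∣p+q∣≤∣p∣+∣q∣ p (ℚ.- q))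
  tail : ℚ.∣ n ℚ.* (r ℚ.- x) ∣ ℚ.≤ n ℚ.* g
  tail = begin
    ℚ.∣ n ℚ.* (r ℚ.- x) ∣        ≡⟨ ℚ.∣p*q∣≡∣p∣*∣q∣ n (r ℚ.- x) ⟩
    ℚ.∣ n ∣ ℚ.* ℚ.∣ r ℚ.- x ∣    ≡⟨ cong (ℚ._* ℚ.∣ r ℚ.- x ∣) (ℚ.0≤p⇒∣p∣≡p (0≤ι (suc N))) ⟩
    n ℚ.* ℚ.∣ r ℚ.- x ∣          ≤⟨ ℚ.*-monoˡ-≤-nonNeg n {{ℚ.nonNegative (0≤ι (suc N))}} (alternating-close m≤t) ⟩
    n ℚ.* g                      ∎
  last : ℚ.∣ s ∣ ℚ.≤ n ℚ.* g
  last = subst (ℚ._≤ n ℚ.* g) (sym (ℚ.0≤p⇒∣p∣≡p (0≤ι (oddQuotients N m))))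
    (ℚ.≤-trans (ι-mono-≤ (oddQuotients≤ N m)) (/-upper N (m ℕ.* 2)))
  -- Here 2n ≤ 2m² + 4m, while (m + 2)(2m + 1) = 2m² + 5m + 2 is larger by m + 2.
  double : suc N ℕ.+ suc N ℕ.≤ (m ℕ.+ 2) ℕ.* suc (m ℕ.* 2)
  double = ℕ.≤-trans (ℕ.+-mono-≤ N≤ N≤) (subst (k ℕ.+ k ℕ.≤_) (eq m) (ℕ.m≤m+n (k ℕ.+ k) (m ℕ.+ 2)))
    where
    k = m ℕ.* m ℕ.+ 2 ℕ.* m
    eq : ∀ m → (m ℕ.* m ℕ.+ 2 ℕ.* m) ℕ.+ (m ℕ.* m ℕ.+ 2 ℕ.* m) ℕ.+ (m ℕ.+ 2) ≡ (m ℕ.+ 2) ℕ.* suc (m ℕ.* 2)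
    eq = ℕ.solve-∀

-- The rate √ n

≤-isqrt : ∀ a n → a ℕ.* a ℕ.≤ n → a ℕ.≤ isqrt n
≤-isqrt a n a²≤n = ℕ.≮⇒≥ λ lt → contradiction
  (ℕ.<-≤-trans (proj₂ (isqrt-spec n)) (ℕ.≤-trans (ℕ.*-mono-≤ lt lt) a²≤n)) (ℕ.<-irrefl refl)

n≤isqrt²+2isqrt : ∀ n → n ℕ.≤ isqrt n ℕ.* isqrt n ℕ.+ 2 ℕ.* isqrt n
n≤isqrt²+2isqrt n = ℕ.s≤s⁻¹ (subst (n ℕ.<_) (square (isqrt n)) (proj₂ (isqrt-spec n)))
  where
  square : ∀ m → suc m ℕ.* suc m ≡ suc (m ℕ.* m ℕ.+ 2 ℕ.* m)
  square = ℕ.solve-∀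

-- Carries bounds by ⌊√n⌋ over to every entry of the real `√ n`: the square of ⌊√n⌋ (k + 1) is at
-- most n (k + 1)².
isqrt≤√-approx : ∀ n k → ι (isqrt n) ℚ.≤ √-approx n (suc k)
isqrt≤√-approx n k = ℚ.*-cancelʳ-≤-pos (ι (suc k)) {{ℚ.positive (ι-mono-< {0} {suc k} z<s)}}
  (subst₂ ℚ._≤_ (ι-* (isqrt n) (suc k)) (sym (/-ι (isqrt (n ℕ.* (suc k ℕ.* suc k))) (suc k)))
    (ι-mono-≤ (≤-isqrt (isqrt n ℕ.* suc k) (n ℕ.* (suc k ℕ.* suc k)) (subst (ℕ._≤ n ℕ.* (suc k ℕ.* suc k)) (interchange ℕ.*-commutativeSemigroup (isqrt n) (isqrt n) (suc k) (suc k))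
      (ℕ.*-monoˡ-≤ (suc k ℕ.* suc k) (proj₁ (isqrt-spec n)))))))

-- Entry `t` of the Cauchy sequence representing 𝒞 n - (1 - log 2) n.
𝒞-error : ℕ → ℕ → ℚ
𝒞-error n t = ι (𝒞 n) ℚ.- (1ℚ ℚ.- riemannSum recip 1ℚ (+ 2 / 1) (suc t)) ℚ.* ι n

-- For m = ⌊√n⌋ the bound of `𝒞-estimate` is 2m + 2, which is at most 4m because n ≥ 1 gives m ≥ 1.
𝒞-error-isqrt : ∀ n .{{_ : NonZero n}} t → isqrt n ℕ.≤ suc t → ℚ.∣ 𝒞-error n t ∣ ℚ.≤ ι 4 ℚ.* ι (isqrt n)
𝒞-error-isqrt n@(suc N) t m≤t = ℚ.≤-trans (𝒞-estimate N m t m≤t (n≤isqrt²+2isqrt n))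
  (subst (ι (m ℕ.+ (m ℕ.+ 2)) ℚ.≤_) (ι-* 4 m) (ι-mono-≤ bound))
  where
  open ℕ.≤-Reasoning
  m = isqrt n
  4*≡ : ∀ m → m ℕ.+ (m ℕ.+ 2 ℕ.* m) ≡ 4 ℕ.* m
  4*≡ = ℕ.solve-∀
  bound : m ℕ.+ (m ℕ.+ 2) ℕ.≤ 4 ℕ.* m
  bound = begin
    m ℕ.+ (m ℕ.+ 2 ℕ.* 1)    ≤⟨ ℕ.+-monoʳ-≤ m (ℕ.+-monoʳ-≤ m (ℕ.*-monoʳ-≤ 2 (≤-isqrt 1 n (s≤s z≤n)))) ⟩
    m ℕ.+ (m ℕ.+ 2 ℕ.* m)    ≡⟨ 4*≡ m ⟩
    4 ℕ.* m                  ∎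

archimedean-* : ∀ p δ → 0ℚ ℚ.< δ → ∃[ A ] p ℚ.≤ ι A ℚ.* δ
archimedean-* p δ 0<δ with archimedean (p ℚ.* (ℚ.1/ δ) {{ℚ.>-nonZero 0<δ}})
... | A , p/δ<A = A , (begin
  p                          ≡⟨ ℚ.*-identityʳ p ⟨
  p ℚ.* 1ℚ                   ≡⟨ cong (p ℚ.*_) (ℚ.*-inverseˡ δ) ⟨
  p ℚ.* ((ℚ.1/ δ) ℚ.* δ)     ≡⟨ ℚ.*-assoc p (ℚ.1/ δ) δ ⟨
  p ℚ.* (ℚ.1/ δ) ℚ.* δ       ≤⟨ ℚ.*-monoʳ-≤-nonNeg δ {{ℚ.nonNegative (ℚ.<⇒≤ 0<δ)}} (ℚ.<⇒≤ p/δ<A) ⟩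
  ι A ℚ.* δ                  ∎)
  where
  open ℚ.≤-Reasoning
  instance
    δ-nonZero : ℚ.NonZero δ
    δ-nonZero = ℚ.>-nonZero 0<δ

-- For m = ⌊√n⌋, A² ≤ n gives A ≤ m, hence 4 ≤ m δ and 4m ≤ δ m² ≤ δ n; dividing by n bounds the
-- error by δ.
𝒞-rate : ∀ n .{{_ : NonZero n}} t A δ → 0ℚ ℚ.≤ δ → ι 4 ℚ.≤ ι A ℚ.* δ → A ℕ.* A ℕ.≤ n → isqrt n ℕ.≤ suc t →
  ℚ.∣ (+ 1 / n) ℚ.* ι (𝒞 n) ℚ.- (1ℚ ℚ.- riemannSum recip 1ℚ (+ 2 / 1) (suc t)) ∣ ℚ.≤ δ
𝒞-rate n@(suc N) t A δ 0≤δ 4≤Aδ A²≤n m≤t = begin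
  ℚ.∣ u ℚ.* c ℚ.- l ∣                         ≡⟨ cong (λ z → ℚ.∣ u ℚ.* c ℚ.- z ∣) (ℚ.*-identityʳ l) ⟨
  ℚ.∣ u ℚ.* c ℚ.- l ℚ.* 1ℚ ∣                  ≡⟨ cong (λ z → ℚ.∣ u ℚ.* c ℚ.- l ℚ.* z ∣) (/-ι 1 n) ⟨
  ℚ.∣ u ℚ.* c ℚ.- l ℚ.* (u ℚ.* ι n) ∣         ≡⟨ cong ℚ.∣_∣ (solve 4 (λ u c l n → u :* c :- l :* (u :* n)
                                                   := u :* (c :- l :* n)) refl u c l (ι n)) ⟩
  ℚ.∣ u ℚ.* 𝒞-error n t ∣                     ≡⟨ ℚ.∣p*q∣≡∣p∣*∣q∣ u (𝒞-error n t) ⟩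
  ℚ.∣ u ∣ ℚ.* ℚ.∣ 𝒞-error n t ∣               ≡⟨ cong (ℚ._* ℚ.∣ 𝒞-error n t ∣) (ℚ.0≤p⇒∣p∣≡p (0≤1/suc N)) ⟩
  u ℚ.* ℚ.∣ 𝒞-error n t ∣                     ≤⟨ ℚ.*-monoˡ-≤-nonNeg u {{1/suc-nonNeg N}} (begin
    ℚ.∣ 𝒞-error n t ∣                           ≤⟨ 𝒞-error-isqrt n t m≤t ⟩
    ι 4 ℚ.* ι m                                 ≤⟨ ℚ.*-monoʳ-≤-nonNeg (ι m) {{m-nonNeg}} (ℚ.≤-trans 4≤Aδ
                                                     (ℚ.*-monoʳ-≤-nonNeg δ {{δ-nonNeg}} (ι-mono-≤ (≤-isqrt A n A²≤n)))) ⟩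
    ι m ℚ.* δ ℚ.* ι m                           ≡⟨ solve 2 (λ m d → m :* d :* m := d :* (m :* m)) refl (ι m) δ ⟩
    δ ℚ.* (ι m ℚ.* ι m)                         ≡⟨ cong (δ ℚ.*_) (ι-* m m) ⟨
    δ ℚ.* ι (m ℕ.* m)                           ≤⟨ ℚ.*-monoˡ-≤-nonNeg δ {{δ-nonNeg}} (ι-mono-≤ (proj₁ (isqrt-spec n))) ⟩
    δ ℚ.* ι n                                   ∎) ⟩
  u ℚ.* (δ ℚ.* ι n)                           ≡⟨ solve 3 (λ u d n → u :* (d :* n) := d :* (u :* n)) refl u δ (ι n) ⟩
  δ ℚ.* (u ℚ.* ι n)                           ≡⟨ cong (δ ℚ.*_) (/-ι 1 n) ⟩
  δ ℚ.* 1ℚ                                    ≡⟨ ℚ.*-identityʳ δ ⟩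
  δ                                           ∎
  where
  open ℚ.≤-Reasoning
  m = isqrt n
  u = + 1 / n
  c = ι (𝒞 n)
  l = 1ℚ ℚ.- riemannSum recip 1ℚ (+ 2 / 1) (suc t)
  δ-nonNeg = ℚ.nonNegative 0≤δ
  m-nonNeg = ℚ.nonNegative (0≤ι m)

corollary2p8 : ((λ n → fromℕ (𝒞 n) - (1ℝ - log (+ 2 / 1)) * fromℕ n) =O (λ n → √ n))
    × Limit (λ n → fromℚ (+ 1 / n) * fromℕ (𝒞 n)) (1ℝ - log (+ 2 / 1))
-- The constants are M = 4 and a = 0. Entries are compared from index ⌊√n⌋ on, where the Riemann sum
-- has more than ⌊√n⌋ steps.
corollary2p8 = (fromℕ 4 , 0 , λ n _ ε 0<ε → isqrt n , λ t m≤t → begin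
    ℚ.∣ 𝒞-error n t ∣                          ≤⟨ 𝒞-error-isqrt n t (ℕ.m≤n⇒m≤1+n m≤t) ⟩
    ι 4 ℚ.* ι (isqrt n)                        ≤⟨ ℚ.*-monoˡ-≤-nonNeg (ι 4) (isqrt≤√-approx n t) ⟩
    ι 4 ℚ.* √-approx n (suc t)                 ≤⟨ p≤p+q (ι 4 ℚ.* √-approx n (suc t)) (ℚ.<⇒≤ 0<ε) ⟩
    ι 4 ℚ.* √-approx n (suc t) ℚ.+ ε           ∎)
  -- Positivity of the real `ε` supplies a rational `δ` below its entries from `T` on. One half of
  -- `δ` bounds the error, the other is the gap that `<` asks for.
  , λ { ε (δ , 0<δ , T , δ≤ε) →
    let δ/2 = ½ ℚ.* δ
        0<δ/2 = subst (ℚ._< δ/2) (ℚ.*-zeroʳ ½) (ℚ.*-monoʳ-<-pos ½ 0<δ)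
        A , 4≤Aδ/2 = archimedean-* (ι 4) δ/2 0<δ/2
    in A ℕ.* A , λ n A²≤n → δ/2 , 0<δ/2 , T ℕ.⊔ isqrt n , λ t ≤t → begin
      ℚ.∣ (+ 1 / n) ℚ.* ι (𝒞 n) ℚ.- (1ℚ ℚ.- riemannSum recip 1ℚ (+ 2 / 1) (suc t)) ∣ ℚ.+ δ/2
        ≤⟨ ℚ.+-monoˡ-≤ δ/2 (𝒞-rate n t A δ/2 (ℚ.<⇒≤ 0<δ/2) 4≤Aδ/2 A²≤n
             (ℕ.m≤n⇒m≤1+n (ℕ.m⊔n≤o⇒n≤o T (isqrt n) ≤t))) ⟩
      δ/2 ℚ.+ δ/2
        ≡⟨ solve 1 (λ d → con ½ :* d :+ con ½ :* d := con 0ℚ :+ d) refl δ ⟩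
      0ℚ ℚ.+ δ
        ≤⟨ δ≤ε t (ℕ.m⊔n≤o⇒m≤o T (isqrt n) ≤t) ⟩
      seq ε t ∎ }
  where open ℚ.≤-Reasoning
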